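{- Let $p>2$ be a constant and $\varepsilon\in(0,1)$. Suppose that a randomized algorithm solves the $\ell_p$ regression problem up to a relative error of $(1+\varepsilon/3)$, i.e., given any $A\in\mathbb R^{n\times d}$ and query access to any $b\in\mathbb R^n$ it outputs $\tilde x$ with $$\|A\tilde x-b\|_p^p\le(1+\varepsilon/3)\min_{x\in\mathbb R^d}\|Ax-b\|_p^p$$ with probability at least $0.99$, and that it queries $m$ entries of $b$ in expectation. Then $m=\Omega(d^{p/2}/\varepsilon^{p-1})$.
   Context: Active $\ell_p$ regression: the design matrix $A$ is fully known to the algorithm, while each entry of the target vector $b$ read counts as one query. The lower bound is worst case over instances with $d$ columns ($n$ may be chosen as a function of $d,\varepsilon,p$); $m$ is the worst-case expected number of queries. The constant in $\Omega(\cdot)$ may depend on $p$. -}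

module Defs where

open import Level using (0ℓ; suc)
open import Algebra.Bundles using (CommutativeRing)
open import Data.Fin.Base using (Fin; toℕ)
open import Data.List.Base using (List; []; _∷_)
import Data.Nat.Base as ℕ
open ℕ using (ℕ)
open import Data.Product.Base using (Σ; ∃; ∃-syntax; _,_; proj₁; proj₂; _×_)
open import Data.Sum.Base using (_⊎_; inj₁; inj₂; [_,_]′)
open import Data.Vec.Functional using (Vector)
open import Relation.Binary.Core using (Rel)
open import Relation.Binary.Definitions using (Cotransitive)
open import Relation.Binary.PropositionalEquality.Core using (_≡_; _≢_)
open import Relation.Binary.Structures using (IsStrictPartialOrder)
open import Relation.Nullary.Negation.Core using (¬_)
open import Relation.Unary using (Pred; _≐_; _∩_; ∁; U; ⋃; Empty)
open import Algebra.Properties.Monoid.Sum using (sum)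
import Algebra.Properties.Monoid.Mult as Mult

-- The real numbers, as a Cauchy-complete Archimedean ordered field.  These
-- axioms determine ℝ up to unique isomorphism; they are phrased without
-- trichotomy, so they do not presuppose excluded middle.
record RealField : Set₁ where
  infix 4 _<_
  field
    commutativeRing : CommutativeRing 0ℓ 0ℓ

  open CommutativeRing commutativeRing public
    renaming (Carrier to ℝ)
    hiding (_≉_)

  Σ[_] : ∀ {n} → Vector ℝ n → ℝ
  Σ[_] = sum +-monoid

  fromℕ : ℕ → ℝ
  fromℕ n = Mult._×_ +-monoid n 1#

  field
    _<_                  : Rel ℝ 0ℓ
    isStrictPartialOrder : IsStrictPartialOrder _≈_ _<_
    <-cotrans            : Cotransitive _<_
    <-tight              : ∀ {x y} → ¬ x < y → ¬ y < x → x ≈ y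
    0<1                  : 0# < 1#
    +-monoˡ-<            : ∀ {x y} z → x < y → x + z < y + z
    *-pos                : ∀ {x y} → 0# < x → 0# < y → 0# < x * y
    -- Inverses of negative numbers follow by negation.
    inverse              : ∀ {x} → 0# < x → ∃[ y ] (0# < y × x * y ≈ 1#)
    archimedean          : ∀ x → ∃[ n ] x < fromℕ n

  infix 4 _≤_
  _≤_ : Rel ℝ 0ℓ
  x ≤ y = ¬ y < x

  Cauchy : (ℕ → ℝ) → Set
  Cauchy s = ∀ δ → 0# < δ →
    ∃[ N ] (∀ i j → N ℕ.≤ i → N ℕ.≤ j → s i - s j < δ)

  infix 4 _⟶_
  _⟶_ : (ℕ → ℝ) → ℝ → Set
  s ⟶ l = ∀ δ → 0# < δ →
    ∃[ N ] (∀ i → N ℕ.≤ i → s i - l < δ × l - s i < δ)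

  field
    complete : ∀ s → Cauchy s → ∃[ l ] s ⟶ l

  open IsStrictPartialOrder isStrictPartialOrder public
    using (<-respʳ-≈; <-respˡ-≈)
    renaming (irrefl to <-irrefl; trans to <-trans)

  partialSum : (ℕ → ℝ) → ℕ → ℝ
  partialSum s L = Σ[ (λ (k : Fin L) → s (toℕ k)) ]

  ℝ⁺ : Set
  ℝ⁺ = Σ ℝ (0# <_)

  infixl 7 _/_
  _/_ : ℝ → ℝ⁺ → ℝ
  x / (_ , 0<y) = x * proj₁ (inverse 0<y)

  +-pos : ∀ {x y} → 0# < x → 0# < y → 0# < x + y
  +-pos {x} {y} 0<x 0<y =
    <-trans 0<y (<-respˡ-≈ (+-identityˡ y) (+-monoˡ-< y 0<x))

  fromℕ-pos : ∀ n → 0# < fromℕ (ℕ.suc n)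
  fromℕ-pos ℕ.zero    = <-respʳ-≈ (sym (+-identityʳ 1#)) 0<1
  fromℕ-pos (ℕ.suc n) = +-pos 0<1 (fromℕ-pos n)

  fromℕ⁺ : (n : ℕ) → .{{ℕ.NonZero n}} → ℝ⁺
  fromℕ⁺ (ℕ.suc n) = fromℕ (ℕ.suc n) , fromℕ-pos n

  /-pos : ∀ {x} → 0# < x → (y : ℝ⁺) → 0# < x / y
  /-pos 0<x (_ , 0<y) = *-pos 0<x (proj₁ (proj₂ (inverse 0<y)))

-- ∣ x ∣^ a, the a-th power of the absolute value of x, for real a > 0.  The
-- laws determine it uniquely: for fixed a it is a monotone multiplicative map
-- on the positive reals, hence x ↦ x^h(a) with h(a) ≥ 0, and pow-1 and pow-+
-- make h additive with h(1) = 1, so that h(a) = a.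
record RealPower (R : RealField) : Set where
  open RealField R
  field
    ∣_∣^_     : ℝ → ℝ⁺ → ℝ
    pow-cong  : ∀ {x y} {a b : ℝ⁺} → x ≈ y → proj₁ a ≈ proj₁ b →
                ∣ x ∣^ a ≈ ∣ y ∣^ b
    pow-even  : ∀ x a → ∣ - x ∣^ a ≈ ∣ x ∣^ a
    pow-mono  : ∀ {x y} a → 0# ≤ x → x ≤ y → ∣ x ∣^ a ≤ ∣ y ∣^ a
    pow-nonneg : ∀ x a → 0# ≤ ∣ x ∣^ a
    pow-pos   : ∀ {x} a → 0# < x → 0# < ∣ x ∣^ a
    pow-1     : ∀ {x} → 0# ≤ x → ∣ x ∣^ (1# , 0<1) ≈ x
    pow-distrib : ∀ x y a → ∣ x * y ∣^ a ≈ ∣ x ∣^ a * ∣ y ∣^ a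
    pow-+     : ∀ x (a b c : ℝ⁺) → proj₁ a + proj₁ b ≈ proj₁ c →
                ∣ x ∣^ a * ∣ x ∣^ b ≈ ∣ x ∣^ c
    pow-*     : ∀ x (a b c : ℝ⁺) → proj₁ a * proj₁ b ≈ proj₁ c →
                ∣ ∣ x ∣^ a ∣^ b ≈ ∣ x ∣^ c

-- Kolmogorov probability spaces.  P-∁ is a consequence of countable additivity
-- in classical logic; it is listed because E ∪ ∁ E need not be the whole space
-- constructively.
record ProbabilitySpace (R : RealField) : Set₂ where
  open RealField R
  field
    Ω       : Set
    IsEvent : Pred (Pred Ω 0ℓ) (suc 0ℓ)
    event-≐ : ∀ {E F} → E ≐ F → IsEvent E → IsEvent F
    event-U : IsEvent U
    event-∁ : ∀ {E} → IsEvent E → IsEvent (∁ E)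
    event-⋃ : ∀ (E : ℕ → Pred Ω 0ℓ) → (∀ k → IsEvent (E k)) → IsEvent (⋃ ℕ E)
    P        : ∀ {E} → IsEvent E → ℝ
    P-cong   : ∀ {E F} (e : IsEvent E) (f : IsEvent F) → E ≐ F → P e ≈ P f
    P-nonneg : ∀ {E} (e : IsEvent E) → 0# ≤ P e
    P-U      : P event-U ≈ 1#
    P-∁      : ∀ {E} (e : IsEvent E) → P (event-∁ e) ≈ 1# - P e
    P-⋃      : ∀ E (e : ∀ k → IsEvent (E k)) →
               (∀ {i j} → i ≢ j → Empty (E i ∩ E j)) →
               partialSum (λ k → P (e k)) ⟶ P (event-⋃ E e)

module Regression (R : RealField) (W : RealPower R) where
  open RealField R
  open RealPower W

  Matrix : ℕ → ℕ → Set
  Matrix n d = Vector (Vector ℝ d) n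

  _·_ : ∀ {n d} → Matrix n d → Vector ℝ d → Vector ℝ n
  (A · x) i = Σ[ (λ j → A i j * x j) ]

  -- ‖ A x - b ‖_p^p
  loss : ∀ {n d} → ℝ⁺ → Matrix n d → Vector ℝ n → Vector ℝ d → ℝ
  loss p A b x = Σ[ (λ i → ∣ (A · x) i - b i ∣^ p) ]

  IsMinimum : {X : Set} → (X → ℝ) → ℝ → Set
  IsMinimum f μ = (∃[ x ] f x ≈ μ) × (∀ y → μ ≤ f y)

  NearOptimal : ∀ {n d} → ℝ⁺ → ℝ → Matrix n d → Vector ℝ n → Vector ℝ d → Set
  NearOptimal p η A b x̃ =
    ∃[ μ ] (IsMinimum (loss p A b) μ × loss p A b x̃ ≤ (1# + η) * μ)

  -- A deterministic adaptive query algorithm: given the answers received so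
  -- far (latest first), read an entry of b or stop with an output.  It is not
  -- required to stop, nor to respect _≈_ on the answers.
  Strategy : ℕ → ℕ → Set
  Strategy n d = List ℝ → Fin n ⊎ Vector ℝ d

  module _ {n d} (s : Strategy n d) (b : Vector ℝ n) where
    answers : ℕ → List ℝ
    answers ℕ.zero    = []
    answers (ℕ.suc k) =
      [ (λ i → b i ∷ answers k) , (λ _ → answers k) ]′ (s (answers k))

    -- Once this is an output, it stays that output for all later k.
    action : ℕ → Fin n ⊎ Vector ℝ d
    action k = s (answers k)

  record RandomizedAlgorithm (n d : ℕ) : Set₂ where
    field
      space : ProbabilitySpace R
    open ProbabilitySpace space public
    field
      strategy : Matrix n d → Ω → Strategy n d

    Reads : Matrix n d → Vector ℝ n → ℕ → Fin n → Pred Ω 0ℓ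
    Reads A b k i ω = action (strategy A ω) b k ≡ inj₁ i

    field
      reads-event : ∀ A b k i → IsEvent (Reads A b k i)

    Outputs : Matrix n d → Vector ℝ n → Pred (Vector ℝ d) 0ℓ → Pred Ω 0ℓ
    Outputs A b Q ω =
      ∃[ k ] ∃[ x̃ ] (action (strategy A ω) b k ≡ inj₂ x̃ × Q x̃)

    Solves : ℝ⁺ → ℝ → Set₁
    Solves p η = ∀ A b →
      Σ (IsEvent (Outputs A b (NearOptimal p η A b))) λ e →
        fromℕ 99 / fromℕ⁺ 100 ≤ P e

    -- The number of queries is the sum over k and i of the indicators of
    -- Reads A b k i, so its expectation is the sum of the series of these terms
    -- (infinite if the series diverges).
    expectedReads : Matrix n d → Vector ℝ n → ℕ → ℝ
    expectedReads A b k = Σ[ (λ i → P (reads-event A b k i)) ]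

    ExpectedQueries≤ : ℝ → Set
    ExpectedQueries≤ m = ∀ A b L → partialSum (expectedReads A b) L ≤ m

  module Exponents {p : ℝ} (2<p : fromℕ 2 < p) where
    0<p : 0# < p
    0<p = <-trans (fromℕ-pos 1) 2<p

    0<p-1 : 0# < p - 1#
    0<p-1 = <-respˡ-≈ (-‿inverseʳ 1#) (+-monoˡ-< (- 1#) (<-trans 1<2 2<p))
      where
      1<2 : 1# < fromℕ 2
      1<2 = <-respʳ-≈ (+-congˡ (sym (+-identityʳ 1#)))
              (<-respˡ-≈ (+-identityˡ 1#) (+-monoˡ-< 1# 0<1))

    p⁺ p/2 p-1 : ℝ⁺
    p⁺  = p , 0<p
    p/2 = p / fromℕ⁺ 2 , /-pos 0<p (fromℕ⁺ 2)
    p-1 = p - 1# , 0<p-1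

    -- d^(p/2) / ε^(p-1)
    rate : ℕ → ℝ⁺ → ℝ
    rate d (ε , 0<ε) = ∣ fromℕ d ∣^ p/2 / (∣ ε ∣^ p-1 , pow-pos p-1 0<ε)

module Submission where

-- The rows of A are the ±1 images of the N = 2^k words of a binary linear code
-- of length d, and b is either 0 or a unit vector eᵢ.  For b = 0 a near-optimal
-- x satisfies A x = 0 and so loses 1 against eᵢ, whereas x = (ε/d) aᵢ has loss
-- at most (1 - ε)^p + (ε/d)^p Σ_{j ≠ i} |⟨aᵢ, aⱼ⟩|^p.  By linearity this sum is
-- the same for all i, and choosing the generators greedily bounds it by
-- (N - 1) 𝔼|S|^p = O(N d^(p/2)), where S is a sum of d random signs.  Taking
-- N ≈ κ d^(p/2) / ε^(p-1) makes the loss at most 1 - 2ε/3 < 1 / (1 + ε/3), so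
-- the algorithm has to tell 0 from eᵢ and, on input 0, reads every entry i with
-- probability bounded below.  All inequalities ≤ are negations, so the argument
-- may be classical once n = N has been computed.

open import Defs
import Algebra.Properties.AbelianGroup as AbelianGroupProperties
import Algebra.Properties.CommutativeSemiring.Exp as Exp
import Algebra.Properties.Ring as RingProperties
import Algebra.Properties.Semiring.Mult as SemiringMult
import Algebra.Properties.Semiring.Sum as SemiringSum
import Algebra.Solver.Ring as RingSolver
open import Algebra.Solver.Ring.AlmostCommutativeRing
  using (fromCommutativeRing; _-Raw-AlmostCommutative⟶_)
open import Data.Bool.Base using (Bool; true; false; _xor_; if_then_else_)
import Data.Bool.Properties as Bool
open import Data.Fin.Base using (Fin; zero; suc; toℕ; splitAt; punchIn)
import Data.Fin.Properties as Fin
open import Data.Integer.Base as ℤ using (ℤ; +_; -[1+_])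
import Data.Integer.Properties as ℤ
open import Data.List.Base using (List; _∷_)
open import Data.Maybe.Base using (Maybe; just; nothing)
open import Data.Nat.Base as ℕ using (ℕ; zero; suc)
import Data.Nat.Induction as ℕ
import Data.Nat.Properties as ℕ
open import Data.Product.Base using (∃-syntax; _×_; _,_; proj₁; proj₂)
import Data.Sign.Base as Sign
open import Data.Sum.Base using (_⊎_; inj₁; inj₂; [_,_]′; map₁)
open import Data.Sum.Properties using (inj₂-injective)
open import Data.Unit.Base using (tt)
open import Data.Vec.Base using (Vec; []; _∷_; zipWith; replicate; lookup)
open import Data.Vec.Functional using (Vector; removeAt)
open import Data.Vec.Properties using (zipWith-assoc; zipWith-comm; zipWith-identityˡ)
open import Function.Base using (_∘_)
open import Level using (0ℓ)
open import Relation.Binary.Definitions using (tri<; tri≈; tri>)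
open import Relation.Binary.PropositionalEquality as ≡ using (_≡_; _≢_; module ≡-Reasoning)
import Relation.Binary.Reasoning.Base.Triple as Triple
import Relation.Binary.Reasoning.Setoid as SetoidReasoning
open import Relation.Binary.Structures using (IsPreorder)
open import Relation.Nullary using (¬_; Dec; does; yes; no)
open import Relation.Nullary.Decidable using (dec-true; dec-false)
open import Relation.Nullary.Negation using (contradiction)
open import Relation.Unary using (Pred; _∩_; ∁; U; ⋃; Empty)

-- Ordered fields

module OrderedField (R : RealField) where
  open RealField R hiding (zero)
  open RingProperties ring using (-0#≈0#; -‿distribˡ-*; -‿distribʳ-*)
  open AbelianGroupProperties +-abelianGroup using (⁻¹-involutive; ⁻¹-∙-comm)
  open SemiringMult semiring using (×-homo-+; ×1-homo-*)

  fromℕ-+ : ∀ m n → fromℕ (m ℕ.+ n) ≈ fromℕ m + fromℕ n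
  fromℕ-+ = ×-homo-+ 1#

  fromℤ : ℤ → ℝ
  fromℤ (+ n)    = fromℕ n
  fromℤ -[1+ n ] = - fromℕ (suc n)

  private
    module ≈ = SetoidReasoning setoid

    -‿homo : ∀ i → fromℤ (ℤ.- i) ≈ - fromℤ i
    -‿homo (+ zero)   = sym -0#≈0#
    -‿homo (+ suc n)  = refl
    -‿homo -[1+ n ]   = sym (⁻¹-involutive _)

    ⊖-homo : ∀ m n → fromℤ (m ℤ.⊖ n) ≈ fromℕ m - fromℕ n
    ⊖-homo m       zero    = sym (trans (+-congˡ -0#≈0#) (+-identityʳ _))
    ⊖-homo zero    (suc n) = sym (+-identityˡ _)
    ⊖-homo (suc m) (suc n) = begin
      fromℤ (suc m ℤ.⊖ suc n)               ≡⟨ ≡.cong fromℤ (ℤ.[1+m]⊖[1+n]≡m⊖n m n) ⟩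
      fromℤ (m ℤ.⊖ n)                       ≈⟨ ⊖-homo m n ⟩
      fromℕ m - fromℕ n                     ≈⟨ +-congʳ (+-identityˡ _) ⟨
      (0# + fromℕ m) - fromℕ n              ≈⟨ +-congʳ (+-congʳ (-‿inverseʳ 1#)) ⟨
      ((1# - 1#) + fromℕ m) - fromℕ n       ≈⟨ +-congʳ (trans (+-assoc _ _ _) (+-congˡ (+-comm _ _))) ⟩
      (1# + (fromℕ m - 1#)) - fromℕ n       ≈⟨ +-congʳ (+-assoc _ _ _) ⟨
      ((1# + fromℕ m) - 1#) - fromℕ n       ≈⟨ +-assoc _ _ _ ⟩
      (1# + fromℕ m) + (- 1# - fromℕ n)     ≈⟨ +-congˡ (⁻¹-∙-comm 1# _) ⟩
      fromℕ (suc m) - fromℕ (suc n)         ∎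
      where open ≈

    +-homo : ∀ i j → fromℤ (i ℤ.+ j) ≈ fromℤ i + fromℤ j
    +-homo (+ m)    (+ n)    = fromℕ-+ m n
    +-homo (+ m)    -[1+ n ] = ⊖-homo m (suc n)
    +-homo -[1+ m ] (+ n)    = trans (⊖-homo n (suc m)) (+-comm _ _)
    +-homo -[1+ m ] -[1+ n ] = begin
      - fromℕ (suc (suc (m ℕ.+ n)))       ≡⟨ ≡.cong (λ k → - fromℕ (suc k)) (ℕ.+-suc m n) ⟨
      - fromℕ (suc m ℕ.+ suc n)           ≈⟨ -‿cong (fromℕ-+ (suc m) (suc n)) ⟩
      - (fromℕ (suc m) + fromℕ (suc n))   ≈⟨ ⁻¹-∙-comm _ _ ⟨
      - fromℕ (suc m) - fromℕ (suc n)     ∎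
      where open ≈

    *-homo : ∀ i j → fromℤ (i ℤ.* j) ≈ fromℤ i * fromℤ j
    *-homo (+ m) (+ n) = begin
      fromℤ (Sign.+ ℤ.◃ m ℕ.* n)   ≡⟨ ≡.cong fromℤ (ℤ.+◃n≡+n (m ℕ.* n)) ⟩
      fromℕ (m ℕ.* n)              ≈⟨ ×1-homo-* m n ⟩
      fromℕ m * fromℕ n            ∎
      where open ≈
    *-homo (+ m) -[1+ n ] = begin
      fromℤ (Sign.- ℤ.◃ m ℕ.* suc n)   ≡⟨ ≡.cong fromℤ (ℤ.-◃n≡-n (m ℕ.* suc n)) ⟩
      fromℤ (ℤ.- (+ (m ℕ.* suc n)))    ≈⟨ -‿homo (+ (m ℕ.* suc n)) ⟩
      - fromℕ (m ℕ.* suc n)            ≈⟨ -‿cong (×1-homo-* m (suc n)) ⟩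
      - (fromℕ m * fromℕ (suc n))      ≈⟨ -‿distribʳ-* _ _ ⟩
      fromℕ m * - fromℕ (suc n)        ∎
      where open ≈
    *-homo -[1+ m ] (+ n) = begin
      fromℤ (Sign.- ℤ.◃ suc m ℕ.* n)   ≡⟨ ≡.cong fromℤ (ℤ.-◃n≡-n (suc m ℕ.* n)) ⟩
      fromℤ (ℤ.- (+ (suc m ℕ.* n)))    ≈⟨ -‿homo (+ (suc m ℕ.* n)) ⟩
      - fromℕ (suc m ℕ.* n)            ≈⟨ -‿cong (×1-homo-* (suc m) n) ⟩
      - (fromℕ (suc m) * fromℕ n)      ≈⟨ -‿distribˡ-* _ _ ⟩
      - fromℕ (suc m) * fromℕ n        ∎
      where open ≈
    *-homo -[1+ m ] -[1+ n ] = begin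
      fromℕ (suc m ℕ.* suc n)              ≈⟨ ×1-homo-* (suc m) (suc n) ⟩
      fromℕ (suc m) * fromℕ (suc n)        ≈⟨ ⁻¹-involutive _ ⟨
      - - (fromℕ (suc m) * fromℕ (suc n))  ≈⟨ -‿cong (-‿distribˡ-* _ _) ⟩
      - (- fromℕ (suc m) * fromℕ (suc n))  ≈⟨ -‿distribʳ-* _ _ ⟩
      - fromℕ (suc m) * - fromℕ (suc n)    ∎
      where open ≈

    -- Reading the literal 1 as 1# rather than 1# + 0# lets solved identities
    -- mention 1# directly.
    literal : ℤ → ℝ
    literal (+ 1) = 1#
    literal i     = fromℤ i

    literal≈fromℤ : ∀ i → literal i ≈ fromℤ i
    literal≈fromℤ (+ 0)           = refl
    literal≈fromℤ (+ 1)           = sym (+-identityʳ 1#)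
    literal≈fromℤ (+ suc (suc _)) = refl
    literal≈fromℤ -[1+ _ ]        = refl

    literal-morphism : ℤ.+-*-rawRing -Raw-AlmostCommutative⟶ fromCommutativeRing commutativeRing
    literal-morphism = record
      { ⟦_⟧    = literal
      ; +-homo = λ i j → trans (literal≈fromℤ (i ℤ.+ j))
          (trans (+-homo i j) (sym (+-cong (literal≈fromℤ i) (literal≈fromℤ j))))
      ; *-homo = λ i j → trans (literal≈fromℤ (i ℤ.* j))
          (trans (*-homo i j) (sym (*-cong (literal≈fromℤ i) (literal≈fromℤ j))))
      ; -‿homo = λ i → trans (literal≈fromℤ (ℤ.- i))
          (trans (-‿homo i) (sym (-‿cong (literal≈fromℤ i))))
      ; 0-homo = refl
      ; 1-homo = refl
      }

    literal-≟ : ∀ i j → Maybe (literal i ≈ literal j)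
    literal-≟ i j with i ℤ.≟ j
    ... | yes ≡.refl = just refl
    ... | no _       = nothing

  open RingSolver ℤ.+-*-rawRing (fromCommutativeRing commutativeRing) literal-morphism literal-≟ public
    using (solve; _:=_; _:+_; _:*_; _:-_; :-_; con)

  -- Order and finite sums.

  <-asym : ∀ {x y} → x < y → ¬ y < x
  <-asym x<y y<x = <-irrefl refl (<-trans x<y y<x)

  ≤-refl : ∀ {x} → x ≤ x
  ≤-refl = <-irrefl refl

  ≤-reflexive : ∀ {x y} → x ≈ y → x ≤ y
  ≤-reflexive x≈y = <-irrefl (sym x≈y)

  <⇒≤ : ∀ {x y} → x < y → x ≤ y
  <⇒≤ = <-asym

  <-≤-trans : ∀ {x y z} → x < y → y ≤ z → x < z
  <-≤-trans {x} {y} {z} x<y y≤z with <-cotrans x<y z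
  ... | inj₁ x<z = x<z
  ... | inj₂ z<y = contradiction z<y y≤z

  ≤-<-trans : ∀ {x y z} → x ≤ y → y < z → x < z
  ≤-<-trans {x} {y} {z} x≤y y<z with <-cotrans y<z x
  ... | inj₁ y<x = contradiction y<x x≤y
  ... | inj₂ x<z = x<z

  ≤-trans : ∀ {x y z} → x ≤ y → y ≤ z → x ≤ z
  ≤-trans x≤y y≤z z<x = y≤z (<-≤-trans z<x x≤y)

  ≤-isPreorder : IsPreorder _≈_ _≤_
  ≤-isPreorder = record
    { isEquivalence = isEquivalence
    ; reflexive     = ≤-reflexive
    ; trans         = ≤-trans
    }

  module ≤-Reasoning = Triple ≤-isPreorder
    <-asym <-trans (<-respʳ-≈ , <-respˡ-≈) <⇒≤ <-≤-trans ≤-<-trans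

  ≤-total : ∀ x y → ¬ ¬ (x ≤ y ⊎ y ≤ x)
  ≤-total x y k = k (inj₁ (λ y<x → k (inj₂ (<-asym y<x))))

  -- Totality of `≤` holds only up to double negation, but the goal `u ≤ v` is itself a negation, so
  -- a classical case split is allowed.
  ≤-cases : ∀ x y {u v} → (x ≤ y → u ≤ v) → (y ≤ x → u ≤ v) → u ≤ v
  ≤-cases x y f g v<u = ≤-total x y [ (λ h → f h v<u) , (λ h → g h v<u) ]′

  +-monoˡ-≤ : ∀ z {x y} → x ≤ y → x + z ≤ y + z
  +-monoˡ-≤ z {x} {y} x≤y y+z<x+z =
    x≤y (<-respˡ-≈ (cancel y) (<-respʳ-≈ (cancel x) (+-monoˡ-< (- z) y+z<x+z)))
    where
    cancel : ∀ w → w + z - z ≈ w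
    cancel w = solve 2 (λ w z → w :+ z :- z := w) refl w z

  +-monoʳ-≤ : ∀ z {x y} → x ≤ y → z + x ≤ z + y
  +-monoʳ-≤ z {x} {y} x≤y =
    ≤-trans (≤-reflexive (+-comm z x)) (≤-trans (+-monoˡ-≤ z x≤y) (≤-reflexive (+-comm y z)))

  +-mono-≤ : ∀ {x y u v} → x ≤ y → u ≤ v → x + u ≤ y + v
  +-mono-≤ {y = y} {u} x≤y u≤v = ≤-trans (+-monoˡ-≤ u x≤y) (+-monoʳ-≤ y u≤v)

  +-monoʳ-< : ∀ z {x y} → x < y → z + x < z + y
  +-monoʳ-< z {x} {y} x<y = <-respˡ-≈ (+-comm x z) (<-respʳ-≈ (+-comm y z) (+-monoˡ-< z x<y))

  +-nonneg : ∀ {x y} → 0# ≤ x → 0# ≤ y → 0# ≤ x + y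
  +-nonneg 0≤x 0≤y = ≤-trans (≤-reflexive (sym (+-identityˡ 0#))) (+-mono-≤ 0≤x 0≤y)

  x<y⇒0<y-x : ∀ {x y} → x < y → 0# < y - x
  x<y⇒0<y-x {x} x<y = <-respˡ-≈ (-‿inverseʳ x) (+-monoˡ-< (- x) x<y)

  x≤y⇒0≤y-x : ∀ {x y} → x ≤ y → 0# ≤ y - x
  x≤y⇒0≤y-x {x} x≤y = ≤-trans (≤-reflexive (sym (-‿inverseʳ x))) (+-monoˡ-≤ (- x) x≤y)

  -- Reduces an inequality to a nonnegative slack `d` and an identity, which is usually one for the
  -- ring solver.
  x+d≈y⇒x≤y : ∀ {x y} d → 0# ≤ d → x + d ≈ y → x ≤ y
  x+d≈y⇒x≤y {x} d 0≤d x+d≈y =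
    ≤-trans (≤-reflexive (sym (+-identityʳ x))) (≤-trans (+-monoʳ-≤ x 0≤d) (≤-reflexive x+d≈y))

  x+d≈y⇒x<y : ∀ {x y} d → 0# < d → x + d ≈ y → x < y
  x+d≈y⇒x<y {x} d 0<d x+d≈y = <-respˡ-≈ (+-identityʳ x) (<-respʳ-≈ x+d≈y (+-monoʳ-< x 0<d))

  0≤1 : 0# ≤ 1#
  0≤1 = <⇒≤ 0<1

  fromℕ-nonneg : ∀ n → 0# ≤ fromℕ n
  fromℕ-nonneg zero    = ≤-refl
  fromℕ-nonneg (suc n) = <⇒≤ (fromℕ-pos n)

  -- If the product is negative, neither factor can be 0. By tightness each factor is then positive
  -- up to double negation, which is enough to refute the assumption.
  *-nonneg : ∀ {x y} → 0# ≤ x → 0# ≤ y → 0# ≤ x * y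
  *-nonneg {x} {y} 0≤x 0≤y xy<0 = ¬¬0<x λ 0<x → ¬¬0<y λ 0<y → <-asym xy<0 (*-pos 0<x 0<y)
    where
    ¬¬0<x : ¬ ¬ 0# < x
    ¬¬0<x x≤0 = <-irrefl (trans (*-congʳ (<-tight 0≤x x≤0)) (zeroˡ y)) xy<0
    ¬¬0<y : ¬ ¬ 0# < y
    ¬¬0<y y≤0 = <-irrefl (trans (*-congˡ (<-tight 0≤y y≤0)) (zeroʳ x)) xy<0

  *-monoˡ-≤ : ∀ {z} → 0# ≤ z → ∀ {x y} → x ≤ y → x * z ≤ y * z
  *-monoˡ-≤ {z} 0≤z {x} {y} x≤y = x+d≈y⇒x≤y ((y - x) * z) (*-nonneg (x≤y⇒0≤y-x x≤y) 0≤z)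
    (solve 3 (λ x y z → x :* z :+ (y :- x) :* z := y :* z) refl x y z)

  *-monoʳ-≤ : ∀ {z} → 0# ≤ z → ∀ {x y} → x ≤ y → z * x ≤ z * y
  *-monoʳ-≤ {z} 0≤z {x} {y} x≤y =
    ≤-trans (≤-reflexive (*-comm z x)) (≤-trans (*-monoˡ-≤ 0≤z x≤y) (≤-reflexive (*-comm y z)))

  square-nonneg : ∀ x → 0# ≤ x * x
  square-nonneg x = ≤-cases 0# x (λ 0≤x → *-nonneg 0≤x 0≤x) λ x≤0 →
    let 0≤-x = ≤-trans (x≤y⇒0≤y-x x≤0) (≤-reflexive (+-identityˡ (- x)))
    in ≤-trans (*-nonneg 0≤-x 0≤-x) (≤-reflexive (solve 1 (λ x → (:- x) :* (:- x) := x :* x) refl x))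

  open Exp commutativeSemiring public using (_^_; ^-congˡ; ^-distrib-*)

  ^-nonneg : ∀ {x} n → 0# ≤ x → 0# ≤ x ^ n
  ^-nonneg zero    0≤x = 0≤1
  ^-nonneg (suc n) 0≤x = *-nonneg 0≤x (^-nonneg n 0≤x)

  open SemiringSum semiring public
    using (sum-cong-≋; sum-replicate-zero; sum-remove; ∑-comm; *-distribˡ-sum)

  Σ-mono-≤ : ∀ {n} {f g : Vector ℝ n} → (∀ i → f i ≤ g i) → Σ[ f ] ≤ Σ[ g ]
  Σ-mono-≤ {zero}  f≤g = ≤-refl
  Σ-mono-≤ {suc n} f≤g = +-mono-≤ (f≤g zero) (Σ-mono-≤ (f≤g ∘ suc))

  Σ-nonneg : ∀ {n} {f : Vector ℝ n} → (∀ i → 0# ≤ f i) → 0# ≤ Σ[ f ]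
  Σ-nonneg {n} 0≤f = ≤-trans (≤-reflexive (sym (sum-replicate-zero n))) (Σ-mono-≤ 0≤f)

  Σ-const : ∀ n x → Σ[ (λ (_ : Fin n) → x) ] ≈ fromℕ n * x
  Σ-const zero    x = sym (zeroˡ x)
  Σ-const (suc n) x = trans (+-cong (sym (*-identityˡ x)) (Σ-const n x)) (sym (distribʳ x 1# (fromℕ n)))

  term≤Σ : ∀ {n} {f : Vector ℝ n} → (∀ i → 0# ≤ f i) → ∀ i → f i ≤ Σ[ f ]
  term≤Σ {suc n} {f} 0≤f i =
    x+d≈y⇒x≤y _ (Σ-nonneg (λ j → 0≤f (punchIn i j))) (sym (sum-remove {i = i} f))

-- Probability

module Probability (R : RealField) where
  open RealField R hiding (zero)
  open OrderedField R

  partialSum-mono-≤ : ∀ {s} → (∀ k → 0# ≤ s k) → ∀ {L N} → L ℕ.≤ N → partialSum s L ≤ partialSum s N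
  partialSum-mono-≤ {s} 0≤s {N = N} ℕ.z≤n = Σ-nonneg {N} (0≤s ∘ toℕ)
  partialSum-mono-≤ {s} 0≤s (ℕ.s≤s L≤N) = +-monoʳ-≤ (s 0) (partialSum-mono-≤ (0≤s ∘ suc) L≤N)

  -- An excess of the `L`-th partial sum over `l` would persist by monotonicity, so it serves as the
  -- tolerance that convergence violates.
  partialSum≤limit : ∀ {s l} → (∀ k → 0# ≤ s k) → partialSum s ⟶ l → ∀ L → partialSum s L ≤ l
  partialSum≤limit {s} {l} 0≤s s⟶l L l<sL with s⟶l (partialSum s L - l) (x<y⇒0<y-x l<sL)
  ... | N , close = +-monoˡ-≤ (- l) (partialSum-mono-≤ 0≤s (ℕ.m≤m⊔n L N))
                      (proj₁ (close (L ℕ.⊔ N) (ℕ.m≤n⊔m L N)))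

  module _ (space : ProbabilitySpace R) where
    open ProbabilitySpace space

    P≤1 : ∀ {E} (e : IsEvent E) → P e ≤ 1#
    P≤1 e = x+d≈y⇒x≤y (P (event-∁ e)) (P-nonneg (event-∁ e))
      (trans (+-congˡ (P-∁ e)) (solve 1 (λ x → x :+ (con (+ 1) :- x) := con (+ 1)) refl (P e)))

    event-∅ : IsEvent (∁ U)
    event-∅ = event-∁ event-U

    module _ {E F} (e : IsEvent E) (f : IsEvent F) where

      private
        -- Two events padded with empty ones, so that countable additivity applies; the partial sum
        -- of length 2 is then below the limit.
        family : ℕ → Pred Ω 0ℓ
        family 0             = E
        family 1             = F
        family (suc (suc _)) = ∁ U

        family-event : ∀ k → IsEvent (family k)
        family-event 0             = e
        family-event 1             = f
        family-event (suc (suc _)) = event-∅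

      P-disjoint : Empty (E ∩ F) → P e + P f ≤ 1#
      P-disjoint E∩F=∅ = ≤-trans
        (≤-reflexive (+-congˡ (sym (+-identityʳ (P f)))))
        (≤-trans (partialSum≤limit (P-nonneg ∘ family-event) (P-⋃ family family-event disjoint) 2)
                 (P≤1 (event-⋃ family family-event)))
        where
        disjoint : ∀ {i j} → i ≢ j → Empty (family i ∩ family j)
        disjoint {0}             {0}             i≢j _ _       = i≢j ≡.refl
        disjoint {0}             {1}             _   ω ∈both   = E∩F=∅ ω ∈both
        disjoint {1}             {0}             _   ω (x , y) = E∩F=∅ ω (y , x)
        disjoint {1}             {1}             i≢j _ _       = i≢j ≡.refl
        disjoint {_}             {suc (suc _)}   _   _ (_ , y) = y tt
        disjoint {suc (suc _)}   {_}             _   _ (x , _) = x tt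

    -- `E` and the complement of `F` are disjoint, so their probabilities add up to at most 1. The
    -- inclusion is the double-negated one, as it is all that the disjointification below provides.
    P-mono : ∀ {E F} (e : IsEvent E) (f : IsEvent F) → Empty (E ∩ ∁ F) → P e ≤ P f
    P-mono e f E∩∁F=∅ = ≤-trans
      (≤-reflexive (solve 2 (λ x y → x := x :+ (con (+ 1) :- y) :- (con (+ 1) :- y)) refl (P e) (P f)))
      (≤-trans (+-monoˡ-≤ _ (≤-trans (+-monoʳ-≤ _ (≤-reflexive (sym (P-∁ f))))
          (P-disjoint e (event-∁ f) E∩∁F=∅)))
        (≤-reflexive (solve 1 (λ y → con (+ 1) :- (con (+ 1) :- y) := y) refl (P f))))

    -- Disjointification: every point outside all the sets
    -- Fₖ ∖ (F₀ ∪ … ∪ Fₖ₋₁) lies outside all the Fₖ.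
    module _ (F : ℕ → Pred Ω 0ℓ) (f : ∀ k → IsEvent (F k)) where

      private
        -- Events are closed under complements and countable unions only, so the difference of `F k`
        -- and its predecessors is encoded as the complement of one union: indices below `k`
        -- contribute `F j`, all others the complement of `F k`.
        Blocked : ∀ k j → Dec (j ℕ.< k) → Pred Ω 0ℓ
        Blocked k j (yes _) = F j
        Blocked k j (no _)  = ∁ (F k)

        blocked-event : ∀ k j j<k? → IsEvent (Blocked k j j<k?)
        blocked-event k j (yes _) = f j
        blocked-event k j (no _)  = event-∁ (f k)

        First : ℕ → Pred Ω 0ℓ
        First k = ∁ (⋃ ℕ (λ j → Blocked k j (j ℕ.<? k)))

        first-event : ∀ k → IsEvent (First k)
        first-event k = event-∁ (event-⋃ _ (λ j → blocked-event k j (j ℕ.<? k)))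

        first⇒¬¬ : ∀ {k ω} → First k ω → ¬ ¬ F k ω
        first⇒¬¬ {k} first ¬Fk = first (k , blocked)
          where
          blocked : Blocked k k (k ℕ.<? k) _
          blocked with k ℕ.<? k
          ... | yes k<k = contradiction k<k (ℕ.<-irrefl ≡.refl)
          ... | no _    = ¬Fk

        first⇒¬earlier : ∀ {j k ω} → j ℕ.< k → First k ω → ¬ F j ω
        first⇒¬earlier {j} {k} j<k first Fj = first (j , blocked)
          where
          blocked : Blocked k j (j ℕ.<? k) _
          blocked with j ℕ.<? k
          ... | yes _  = Fj
          ... | no j≮k = contradiction j<k j≮k

        disjoint : ∀ {i j} → i ≢ j → Empty (First i ∩ First j)
        disjoint {i} {j} i≢j ω (x , y) with ℕ.<-cmp i j
        ... | tri< i<j _ _ = first⇒¬¬ x (first⇒¬earlier i<j y)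
        ... | tri≈ _ i≡j _ = i≢j i≡j
        ... | tri> _ _ j<i = first⇒¬¬ y (first⇒¬earlier j<i x)

        -- Strong induction: if no earlier set contains the point, then membership in `F k` would
        -- put it in `First k`.
        ¬first⇒¬F : ∀ {ω} → (∀ k → ¬ First k ω) → ∀ k → ¬ F k ω
        ¬first⇒¬F {ω} ¬first = ℕ.<-rec _ λ k ¬F Fk → ¬first k (first k ¬F Fk)
          where
          first : ∀ k → (∀ {j} → j ℕ.< k → ¬ F j ω) → F k ω → First k ω
          first k ¬F Fk (j , blocked) with j ℕ.<? k
          ... | yes j<k = ¬F j<k blocked
          ... | no _    = blocked Fk

      -- The union bound, stated for a finite partial sum because the series may diverge. The
      -- disjoint sets `First k` have total probability at least 1, and each is bounded by `F k`.
      covering-sum : (∀ ω → ¬ (∀ k → ¬ F k ω)) →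
        ∀ {δ} → 0# < δ → ∃[ L ] 1# - δ < partialSum (λ k → P (f k)) L
      covering-sum cover {δ} 0<δ with P-⋃ First first-event disjoint δ 0<δ
      ... | L , close = L , (begin-strict
        1# - δ                                    ≤⟨ +-monoˡ-≤ _ 1≤P⋃ ⟩
        P⋃ - δ                                    ≈⟨ solve 3 (λ x y z → x :- z := y :+ ((x :- y) :- z))
            refl P⋃ S δ ⟩
        S + ((P⋃ - S) - δ)                        <⟨ +-monoʳ-< S (+-monoˡ-< (- δ) (proj₂ (close L ℕ.≤-refl))) ⟩
        S + (δ - δ)                               ≈⟨ solve 2 (λ x y → x :+ (y :- y) := x) refl S δ ⟩
        S                                         ≤⟨ Σ-mono-≤ {L} (λ i →
            P-mono (first-event (toℕ i)) (f (toℕ i)) λ ω (x , y) → first⇒¬¬ x y) ⟩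
        partialSum (λ k → P (f k)) L              ∎)
        where
        open ≤-Reasoning
        P⋃ = P (event-⋃ First first-event)
        S = partialSum (λ k → P (first-event k)) L
        1≤P⋃ : 1# ≤ P⋃
        1≤P⋃ = ≤-trans (≤-reflexive (sym P-U)) (P-mono event-U (event-⋃ First first-event)
          λ ω (_ , ¬⋃) → cover ω (¬first⇒¬F (λ k x → ¬⋃ (k , x))))

-- Binary codes and sums of random signs

infixr 6 _⊕_
_⊕_ : ∀ {d} → Vec Bool d → Vec Bool d → Vec Bool d
_⊕_ = zipWith _xor_

𝟎 : ∀ {d} → Vec Bool d
𝟎 = replicate _ false

⊕-assoc : ∀ {d} (u v w : Vec Bool d) → (u ⊕ v) ⊕ w ≡ u ⊕ (v ⊕ w)
⊕-assoc = zipWith-assoc Bool.xor-assoc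

⊕-comm : ∀ {d} (u v : Vec Bool d) → u ⊕ v ≡ v ⊕ u
⊕-comm = zipWith-comm Bool.xor-comm

⊕-self : ∀ {d} (v : Vec Bool d) → v ⊕ v ≡ 𝟎
⊕-self []      = ≡.refl
⊕-self (b ∷ v) = ≡.cong₂ _∷_ (Bool.xor-same b) (⊕-self v)

⊕-cancelˡ : ∀ {d} (u v : Vec Bool d) → u ⊕ (u ⊕ v) ≡ v
⊕-cancelˡ u v = ≡.trans (≡.sym (⊕-assoc u u v))
  (≡.trans (≡.cong (_⊕ v) (⊕-self u)) (zipWith-identityˡ (λ _ → ≡.refl) v))

⊕-swap : ∀ {d} (u v w : Vec Bool d) → u ⊕ (v ⊕ w) ≡ v ⊕ (u ⊕ w)
⊕-swap u v w = ≡.trans (≡.sym (⊕-assoc u v w)) (≡.trans (≡.cong (_⊕ w) (⊕-comm u v)) (⊕-assoc v u w))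

-- Defined by doubling, so that `splitAt` cuts `Fin (2^ suc k)` into two copies of `Fin (2^ k)`.
2^_ : ℕ → ℕ
2^ zero  = 1
2^ suc k = 2^ k ℕ.+ 2^ k

-- Enumerates the span of the generators over the field with two elements, with repetitions when
-- they are dependent. The first half of the indices omits `g`, the second includes it.
codeword : ∀ {k d} → Vec (Vec Bool d) k → Fin (2^ k) → Vec Bool d
codeword                 []       _ = 𝟎
codeword {k = suc k} (g ∷ gs) i = [ codeword gs , (λ j → g ⊕ codeword gs j) ]′ (splitAt (2^ k) i)

module Moments (R : RealField) where
  open RealField R hiding (zero)
  open OrderedField R

  -- `fromℕ-pos n` concerns `suc n`, so the argument 1 yields the inverse of 2; the later
  -- reciprocals are shifted in the same way.
  ½ : ℝ
  ½ = proj₁ (inverse (fromℕ-pos 1))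

  0≤½ : 0# ≤ ½
  0≤½ = <⇒≤ (proj₁ (proj₂ (inverse (fromℕ-pos 1))))

  ½*2 : ∀ x → ½ * (x + x) ≈ x
  ½*2 x = trans (solve 2 (λ h x → h :* (x :+ x) := con (+ 2) :* h :* x) refl ½ x)
    (trans (*-congʳ (proj₂ (proj₂ (inverse (fromℕ-pos 1))))) (*-identityˡ x))

  -- The mean over the uniform distribution on {0,1}^d.
  𝔼 : ∀ {d} → (Vec Bool d → ℝ) → ℝ
  𝔼 {zero}  f = f []
  𝔼 {suc d} f = ½ * (𝔼 (f ∘ (false ∷_)) + 𝔼 (f ∘ (true ∷_)))

  𝔼-mono : ∀ {d} {f g : Vec Bool d → ℝ} → (∀ v → f v ≤ g v) → 𝔼 f ≤ 𝔼 g
  𝔼-mono {zero}  f≤g = f≤g []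
  𝔼-mono {suc d} f≤g = *-monoʳ-≤ 0≤½ (+-mono-≤ (𝔼-mono (f≤g ∘ (false ∷_))) (𝔼-mono (f≤g ∘ (true ∷_))))

  𝔼-cong : ∀ {d} {f g : Vec Bool d → ℝ} → (∀ v → f v ≈ g v) → 𝔼 f ≈ 𝔼 g
  𝔼-cong {zero}  f≈g = f≈g []
  𝔼-cong {suc d} f≈g = *-congˡ (+-cong (𝔼-cong (f≈g ∘ (false ∷_))) (𝔼-cong (f≈g ∘ (true ∷_))))

  𝔼-const : ∀ d x → 𝔼 {d} (λ _ → x) ≈ x
  𝔼-const zero    x = refl
  𝔼-const (suc d) x = trans (*-congˡ (+-cong (𝔼-const d x) (𝔼-const d x))) (½*2 x)

  𝔼-+ : ∀ {d} (f g : Vec Bool d → ℝ) → 𝔼 (λ v → f v + g v) ≈ 𝔼 f + 𝔼 g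
  𝔼-+ {zero}  f g = refl
  𝔼-+ {suc d} f g = trans (*-congˡ (+-cong (𝔼-+ (f ∘ (false ∷_)) _) (𝔼-+ (f ∘ (true ∷_)) _)))
    (solve 5 (λ h a b c d → h :* ((a :+ b) :+ (c :+ d)) := h :* (a :+ c) :+ h :* (b :+ d)) refl ½ _ _ _ _)

  𝔼-* : ∀ {d} c (f : Vec Bool d → ℝ) → 𝔼 (λ v → c * f v) ≈ c * 𝔼 f
  𝔼-* {zero}  c f = refl
  𝔼-* {suc d} c f = trans (*-congˡ (+-cong (𝔼-* c (f ∘ (false ∷_))) (𝔼-* c (f ∘ (true ∷_)))))
    (solve 4 (λ h c a b → h :* (c :* a :+ c :* b) := c :* (h :* (a :+ b))) refl ½ c _ _)

  𝔼-shift : ∀ {d} (f : Vec Bool d → ℝ) u → 𝔼 (λ v → f (v ⊕ u)) ≈ 𝔼 f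
  𝔼-shift f []          = refl
  𝔼-shift f (false ∷ u) = *-congˡ (+-cong (𝔼-shift (f ∘ (false ∷_)) u) (𝔼-shift (f ∘ (true ∷_)) u))
  -- A `true` bit exchanges the two halves of the cube.
  𝔼-shift f (true ∷ u)  = *-congˡ (trans (+-comm _ _)
      (+-cong (𝔼-shift (f ∘ (false ∷_)) u) (𝔼-shift (f ∘ (true ∷_)) u)))

  𝔼-Σ : ∀ {d n} (f : Fin n → Vec Bool d → ℝ) → 𝔼 (λ v → Σ[ (λ i → f i v) ]) ≈ Σ[ (λ i → 𝔼 (f i)) ]
  𝔼-Σ {d} {zero}  f = 𝔼-const d 0#
  𝔼-Σ {d} {suc n} f = trans (𝔼-+ (f zero) _) (+-congˡ (𝔼-Σ (f ∘ suc)))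

  -- The first moment method: descend into the half with the smaller mean. The comparison of the two
  -- means is classical, hence the double negation.
  ∃≤𝔼 : ∀ {d} (f : Vec Bool d → ℝ) → ¬ ¬ (∃[ v ] f v ≤ 𝔼 f)
  ∃≤𝔼 {zero}  f k = k ([] , ≤-refl)
  ∃≤𝔼 {suc d} f k = ≤-total x y λ where
      (inj₁ x≤y) → ∃≤𝔼 (f ∘ (false ∷_)) λ (v , fv≤x) → k (false ∷ v ,
        ≤-trans fv≤x (≤-trans (≤-reflexive (sym (½*2 x))) (*-monoʳ-≤ 0≤½ (+-monoʳ-≤ x x≤y))))
      (inj₂ y≤x) → ∃≤𝔼 (f ∘ (true ∷_)) λ (v , fv≤y) → k (true ∷ v ,
        ≤-trans fv≤y (≤-trans (≤-reflexive (sym (½*2 y))) (*-monoʳ-≤ 0≤½ (+-monoˡ-≤ y y≤x))))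
    where
    x = 𝔼 (f ∘ (false ∷_))
    y = 𝔼 (f ∘ (true ∷_))

  sign : Bool → ℝ
  sign false = 1#
  sign true  = - 1#

  sign-xor : ∀ a b → sign (a xor b) ≈ sign a * sign b
  sign-xor false b     = sym (*-identityˡ (sign b))
  sign-xor true  false = sym (*-identityʳ (- 1#))
  sign-xor true  true  = solve 0 (con (+ 1) := (:- con (+ 1)) :* (:- con (+ 1))) refl

  signSum : ∀ {d} → Vec Bool d → ℝ
  signSum []      = 0#
  signSum (b ∷ v) = sign b + signSum v

  -- `sign` turns xor into multiplication, so the inner product of two sign vectors is the sign sum
  -- of their xor. The factor `t` stands where multiplying a matrix by a scaled row puts it.
  signSum-⊕ : ∀ {d} t (u v : Vec Bool d) →
    Σ[ (λ c → sign (lookup u c) * (t * sign (lookup v c))) ] ≈ t * signSum (v ⊕ u)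
  signSum-⊕ t []      []      = sym (zeroʳ t)
  signSum-⊕ t (a ∷ u) (b ∷ v) = begin-equality
    sign a * (t * sign b) + Σ[ (λ c → sign (lookup u c) * (t * sign (lookup v c))) ]
        ≈⟨ +-congˡ (signSum-⊕ t u v) ⟩
    sign a * (t * sign b) + t * signSum (v ⊕ u)
      ≈⟨ solve 4 (λ a b t s → a :* (t :* b) :+ t :* s := t :* (b :* a :+ s))
          refl (sign a) (sign b) t (signSum (v ⊕ u)) ⟩
    t * (sign b * sign a + signSum (v ⊕ u))   ≈⟨ *-congˡ (+-congʳ (sign-xor b a)) ⟨
    t * (sign (b xor a) + signSum (v ⊕ u))    ∎
    where open ≤-Reasoning

  signSum-𝟎 : ∀ d → signSum (𝟎 {d}) ≈ fromℕ d
  signSum-𝟎 zero    = refl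
  signSum-𝟎 (suc d) = +-congˡ (signSum-𝟎 d)

  -- (y ± 2 s)^q = even q ± s · odd q.
  module _ {s y K : ℝ} (s²≤y : s * s ≤ y) (0≤K : 0# ≤ K) where
    private
      0≤y : 0# ≤ y
      0≤y = ≤-trans (square-nonneg s) s²≤y

      Z = y + K

      0≤Z : 0# ≤ Z
      0≤Z = +-nonneg 0≤y 0≤K

      y≤Z : y ≤ Z
      y≤Z = x+d≈y⇒x≤y K 0≤K refl

      even odd : ℕ → ℝ
      even zero    = 1#
      even (suc q) = y * even q + fromℕ 2 * (s * s * odd q)
      odd zero    = 0#
      odd (suc q) = fromℕ 2 * even q + y * odd q

      even-nonneg : ∀ q → 0# ≤ even q
      odd-nonneg  : ∀ q → 0# ≤ odd q
      even-nonneg zero    = 0≤1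
      even-nonneg (suc q) = +-nonneg (*-nonneg 0≤y (even-nonneg q))
        (*-nonneg (fromℕ-nonneg 2) (*-nonneg (square-nonneg s) (odd-nonneg q)))
      odd-nonneg zero    = ≤-refl
      odd-nonneg (suc q) = +-nonneg (*-nonneg (fromℕ-nonneg 2) (even-nonneg q)) (*-nonneg 0≤y (odd-nonneg q))

      expand+ : ∀ q → (y + fromℕ 2 * s) ^ q ≈ even q + s * odd q
      expand+ zero    = sym (trans (+-congˡ (zeroʳ s)) (+-identityʳ 1#))
      expand+ (suc q) = trans (*-congˡ (expand+ q))
        (solve 4 (λ s y e o → (y :+ con (+ 2) :* s) :* (e :+ s :* o)
          := y :* e :+ con (+ 2) :* (s :* s :* o) :+ s :* (con (+ 2) :* e :+ y :* o)) refl s y _ _)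

      expand- : ∀ q → (y - fromℕ 2 * s) ^ q ≈ even q - s * odd q
      expand- zero    = solve 1 (λ s → con (+ 1) := con (+ 1) :- s :* con (+ 0)) refl s
      expand- (suc q) = trans (*-congˡ (expand- q))
        (solve 4 (λ s y e o → (y :- con (+ 2) :* s) :* (e :- s :* o)
          := y :* e :+ con (+ 2) :* (s :* s :* o) :- s :* (con (+ 2) :* e :+ y :* o)) refl s y _ _)

      -- Both bounds go through one induction. The odd part enters the next even part with factor
      -- 2s², at most 2Z, and so adds at most 4q Z^q; the surplus `K` in `Z` absorbs this.
      bounds : ∀ q → fromℕ 4 * fromℕ q ≤ K →
        even q ≤ Z ^ q × Z * odd q ≤ fromℕ 2 * fromℕ q * Z ^ q
      bounds zero    _ = ≤-refl , ≤-reflexive (solve 1 (λ z → z :* con (+ 0)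
          := con (+ 2) :* con (+ 0) :* con (+ 1)) refl Z)
      bounds (suc q) 4[1+q]≤K = even-bound , odd-bound
        where
        open ≤-Reasoning
        n W : ℝ
        n = fromℕ q
        W = Z ^ q
        0≤W : 0# ≤ W
        0≤W = ^-nonneg q 0≤Z
        4q≤K : fromℕ 4 * n ≤ K
        4q≤K = ≤-trans (*-monoʳ-≤ (fromℕ-nonneg 4) (x+d≈y⇒x≤y 1# 0≤1 (+-comm n 1#))) 4[1+q]≤K
        even≤ = proj₁ (bounds q 4q≤K)
        odd≤  = proj₂ (bounds q 4q≤K)
        even-bound : even (suc q) ≤ Z ^ suc q
        even-bound = begin
          y * even q + fromℕ 2 * (s * s * odd q)
            ≤⟨ +-mono-≤ (*-monoʳ-≤ 0≤y even≤) (*-monoʳ-≤ (fromℕ-nonneg 2)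
                 (≤-trans (*-monoˡ-≤ (odd-nonneg q) (≤-trans s²≤y y≤Z)) odd≤)) ⟩
          y * W + fromℕ 2 * (fromℕ 2 * n * W)
            ≈⟨ solve 3 (λ y n w → y :* w :+ con (+ 2) :* (con (+ 2) :* n :* w)
                := y :* w :+ con (+ 4) :* n :* w) refl y n W ⟩
          y * W + fromℕ 4 * n * W   ≤⟨ +-monoʳ-≤ _ (*-monoˡ-≤ 0≤W 4q≤K) ⟩
          y * W + K * W             ≈⟨ distribʳ W y K ⟨
          Z * W                     ∎
        odd-bound : Z * odd (suc q) ≤ fromℕ 2 * fromℕ (suc q) * Z ^ suc q
        odd-bound = begin
          Z * (fromℕ 2 * even q + y * odd q)
            ≈⟨ solve 4 (λ z y e o → z :* (con (+ 2) :* e :+ y :* o)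
                := con (+ 2) :* (z :* e) :+ y :* (z :* o)) refl Z y (even q) (odd q) ⟩
          fromℕ 2 * (Z * even q) + y * (Z * odd q)
            ≤⟨ +-mono-≤ (*-monoʳ-≤ (fromℕ-nonneg 2) (*-monoʳ-≤ 0≤Z even≤)) (*-monoʳ-≤ 0≤y odd≤) ⟩
          fromℕ 2 * (Z * W) + y * (fromℕ 2 * n * W)
            ≤⟨ +-monoʳ-≤ _ (*-monoˡ-≤ (*-nonneg (*-nonneg (fromℕ-nonneg 2) (fromℕ-nonneg q)) 0≤W) y≤Z) ⟩
          fromℕ 2 * (Z * W) + Z * (fromℕ 2 * n * W)
            ≈⟨ solve 3 (λ z n w → con (+ 2) :* (z :* w) :+ z :* (con (+ 2) :* n :* w)
                 := con (+ 2) :* (con (+ 1) :+ n) :* (z :* w)) refl Z n W ⟩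
          fromℕ 2 * (1# + n) * (Z * W)   ∎

    -- Averaging over the sign of `s` cancels the odd part and leaves `even q`.
    mean-power-≤ : ∀ q → fromℕ 4 * fromℕ q ≤ K →
      ½ * ((y + fromℕ 2 * s) ^ q + (y - fromℕ 2 * s) ^ q) ≤ (y + K) ^ q
    mean-power-≤ q 4q≤K = begin
      ½ * ((y + fromℕ 2 * s) ^ q + (y - fromℕ 2 * s) ^ q)    ≈⟨ *-congˡ (+-cong (expand+ q) (expand- q)) ⟩
      ½ * ((even q + s * odd q) + (even q - s * odd q))
        ≈⟨ *-congˡ (solve 2 (λ e t → (e :+ t) :+ (e :- t) := e :+ e) refl (even q) (s * odd q)) ⟩
      ½ * (even q + even q)   ≈⟨ ½*2 (even q) ⟩
      even q                  ≤⟨ proj₁ (bounds q 4q≤K) ⟩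
      (y + K) ^ q             ∎
      where open ≤-Reasoning

  module _ (q : ℕ) where
    -- The cost of one random sign: 1 for its own square and 4q for the cross term with the sum so
    -- far.
    growth : ℝ
    growth = 1# + fromℕ 4 * fromℕ q

    growth-nonneg : 0# ≤ growth
    growth-nonneg = +-nonneg 0≤1 (*-nonneg (fromℕ-nonneg 4) (fromℕ-nonneg q))

    -- Induction on the number of signs still to come, with `s` the sum so far. After the first
    -- sign, the bounds for the two outcomes have bases that differ only in the term ±2s, which
    -- `mean-power-≤` removes.
    shifted-moment : ∀ d s w → 0# ≤ w →
      𝔼 {d} (λ v → ((s + signSum v) * (s + signSum v) + w) ^ q) ≤ (s * s + w + fromℕ d * growth) ^ q
    shifted-moment zero s w 0≤w = ≤-reflexive (^-congˡ q
      (solve 3 (λ s w g → (s :+ con (+ 0)) :* (s :+ con (+ 0)) :+ w := s :* s :+ w :+ con (+ 0) :* g)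
          refl s w growth))
    shifted-moment (suc d) s w 0≤w = begin
      𝔼 {suc d} (λ v → ((s + signSum v) * (s + signSum v) + w) ^ q)
        ≤⟨ *-monoʳ-≤ 0≤½ (+-mono-≤ (after 1#) (after (- 1#))) ⟩
      ½ * (((s + 1#) * (s + 1#) + w + N) ^ q + ((s - 1#) * (s - 1#) + w + N) ^ q)
        ≈⟨ *-congˡ (+-cong
             (^-congˡ q (solve 3 (λ s w n → (s :+ con (+ 1)) :* (s :+ con (+ 1)) :+ w :+ n
               := (s :* s :+ (con (+ 1) :+ (w :+ n))) :+ con (+ 2) :* s) refl s w N))
             (^-congˡ q (solve 3 (λ s w n → (s :- con (+ 1)) :* (s :- con (+ 1)) :+ w :+ n
               := (s :* s :+ (con (+ 1) :+ (w :+ n))) :- con (+ 2) :* s) refl s w N))) ⟩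
      ½ * ((y + fromℕ 2 * s) ^ q + (y - fromℕ 2 * s) ^ q)
        ≤⟨ mean-power-≤ s²≤y (*-nonneg (fromℕ-nonneg 4) (fromℕ-nonneg q)) q ≤-refl ⟩
      (y + fromℕ 4 * fromℕ q) ^ q
        ≈⟨ ^-congˡ q (solve 4 (λ s w n m → (s :* s :+ (con (+ 1) :+ (w :+ n :* (con (+ 1) :+ con (+ 4) :* m)))) :+ con (+ 4) :* m
             := s :* s :+ w :+ (con (+ 1) :+ n) :* (con (+ 1) :+ con (+ 4) :* m))
                 refl s w (fromℕ d) (fromℕ q)) ⟩
      (s * s + w + fromℕ (suc d) * growth) ^ q ∎
      where
      open ≤-Reasoning
      N y : ℝ
      N = fromℕ d * growth
      y = s * s + (1# + (w + N))
      s²≤y : s * s ≤ y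
      s²≤y = x+d≈y⇒x≤y (1# + (w + N))
        (+-nonneg 0≤1 (+-nonneg 0≤w (*-nonneg (fromℕ-nonneg d) growth-nonneg))) refl
      after : ∀ t → 𝔼 {d} (λ v → ((s + (t + signSum v)) * (s + (t + signSum v)) + w) ^ q)
        ≤ ((s + t) * (s + t) + w + N) ^ q
      after t = ≤-trans
        (≤-reflexive (𝔼-cong {d} λ v → ^-congˡ q (+-congʳ
          (*-cong (sym (+-assoc s t (signSum v))) (sym (+-assoc s t (signSum v)))))))
        (shifted-moment d (s + t) w 0≤w)

    -- Khintchine's inequality for the even exponent 2q: a random walk started at 0.
    signSum-moment : ∀ d → 𝔼 {d} (λ v → (signSum v * signSum v) ^ q) ≤ (fromℕ d * growth) ^ q
    signSum-moment d = begin
      𝔼 {d} (λ v → (signSum v * signSum v) ^ q)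
        ≈⟨ 𝔼-cong {d} (λ v → ^-congˡ q (solve 1 (λ s → s :* s
            := (con (+ 0) :+ s) :* (con (+ 0) :+ s) :+ con (+ 0)) refl (signSum v))) ⟩
      𝔼 {d} (λ v → ((0# + signSum v) * (0# + signSum v) + 0#) ^ q)   ≤⟨ shifted-moment d 0# 0# ≤-refl ⟩
      (0# * 0# + 0# + fromℕ d * growth) ^ q
        ≈⟨ ^-congˡ q (solve 1 (λ x → con (+ 0) :* con (+ 0) :+ con (+ 0) :+ x := x)
            refl (fromℕ d * growth)) ⟩
      (fromℕ d * growth) ^ q   ∎
      where open ≤-Reasoning

  -- Sums over a linear code and the greedy choice of generators.

  Σ-splitAt : ∀ m {n} (f : Fin m ⊎ Fin n → ℝ) → Σ[ f ∘ splitAt m ] ≈ Σ[ f ∘ inj₁ ] + Σ[ f ∘ inj₂ ]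
  Σ-splitAt zero    f = sym (+-identityˡ _)
  Σ-splitAt (suc m) f = trans (+-congˡ (Σ-splitAt m (f ∘ map₁ suc))) (sym (+-assoc _ _ _))

  Σ-codeword : ∀ {k d} g (gs : Vec (Vec Bool d) k) (f : Vec Bool d → ℝ) →
    Σ[ f ∘ codeword (g ∷ gs) ] ≈ Σ[ f ∘ codeword gs ] + Σ[ (λ i → f (g ⊕ codeword gs i)) ]
  Σ-codeword {k} g gs f = Σ-splitAt (2^ k) (f ∘ [ codeword gs , (λ i → g ⊕ codeword gs i) ]′)

  -- The code is a group, so translation by a codeword permutes it. A word without `g` preserves
  -- both halves of the code; a word with `g` exchanges them.
  Σ-codeword-translate : ∀ {k d} (gs : Vec (Vec Bool d) k) (f : Vec Bool d → ℝ) i →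
    Σ[ (λ j → f (codeword gs i ⊕ codeword gs j)) ] ≈ Σ[ f ∘ codeword gs ]
  Σ-codeword-translate [] f i = +-congʳ (reflexive (≡.cong f (⊕-self 𝟎)))
  Σ-codeword-translate {suc k} {d} (g ∷ gs) f i =
    trans (Σ-codeword g gs (λ v → f (codeword (g ∷ gs) i ⊕ v)))
      (trans (halves (splitAt (2^ k) i)) (sym (Σ-codeword g gs f)))
    where
    c : Fin (2^ k) → Vec Bool d
    c = codeword gs
    Σ-cong : ∀ {u v : Fin (2^ k) → Vec Bool d} → (∀ j → u j ≡ v j) → Σ[ f ∘ u ] ≈ Σ[ f ∘ v ]
    Σ-cong u≡v = sum-cong-≋ λ j → reflexive (≡.cong f (u≡v j))
    halves : ∀ i → let u = [ c , (λ j → g ⊕ c j) ]′ i in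
      Σ[ (λ j → f (u ⊕ c j)) ] + Σ[ (λ j → f (u ⊕ (g ⊕ c j))) ] ≈ Σ[ f ∘ c ] + Σ[ (λ j → f (g ⊕ c j)) ]
    halves (inj₁ i) = +-cong (Σ-codeword-translate gs f i)
      (trans (Σ-cong (λ j → ⊕-swap (c i) g (c j))) (Σ-codeword-translate gs (λ v → f (g ⊕ v)) i))
    halves (inj₂ i) = trans (+-comm _ _) (+-cong
      (trans (Σ-cong (λ j → ≡.trans (⊕-assoc g (c i) (g ⊕ c j))
          (≡.trans (≡.cong (g ⊕_) (⊕-swap (c i) g (c j))) (⊕-cancelˡ g (c i ⊕ c j)))))
        (Σ-codeword-translate gs f i))
      (trans (Σ-cong (λ j → ⊕-assoc g (c i) (c j))) (Σ-codeword-translate gs (λ v → f (g ⊕ v)) i)))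

  -- Generators are added one at a time. For uniform `g` each new word is uniform, so the new half
  -- has expected sum `fromℕ (2^ k) * 𝔼 f`, and some `g` does no worse. The extra `𝔼 f` on the left
  -- accounts for the word of index zero, which is always `𝟎`.
  ∃-code : ∀ {d} (f : Vec Bool d → ℝ) k →
    ¬ ¬ (∃[ gs ] Σ[ f ∘ codeword {k} gs ] + 𝔼 f ≤ f 𝟎 + fromℕ (2^ k) * 𝔼 f)
  ∃-code f zero ∄ = ∄ ([] , ≤-reflexive
    (solve 2 (λ x y → x :+ con (+ 0) :+ y := x :+ (con (+ 1) :+ con (+ 0)) :* y) refl (f 𝟎) (𝔼 f)))
  ∃-code f (suc k) ∄ = ∃-code f k λ (gs , bound) → ∃≤𝔼 (λ g → Σ[ (λ i → f (g ⊕ codeword gs i)) ])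
    λ (g , g-bound) → ∄ (g ∷ gs , (begin
      Σ[ f ∘ codeword (g ∷ gs) ] + 𝔼 f
        ≈⟨ +-congʳ (Σ-codeword g gs f) ⟩
      Σ[ f ∘ codeword gs ] + Σ[ (λ i → f (g ⊕ codeword gs i)) ] + 𝔼 f
        ≈⟨ solve 3 (λ x y z → x :+ y :+ z := (x :+ z) :+ y) refl _ _ _ ⟩
      (Σ[ f ∘ codeword gs ] + 𝔼 f) + Σ[ (λ i → f (g ⊕ codeword gs i)) ]
        ≤⟨ +-mono-≤ bound (≤-trans g-bound (≤-reflexive (mean gs))) ⟩
      (f 𝟎 + fromℕ (2^ k) * 𝔼 f) + fromℕ (2^ k) * 𝔼 f
        ≈⟨ solve 3 (λ x n y → (x :+ n :* y) :+ n :* y := x :+ (n :+ n) :* y)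
            refl (f 𝟎) (fromℕ (2^ k)) (𝔼 f) ⟩
      f 𝟎 + (fromℕ (2^ k) + fromℕ (2^ k)) * 𝔼 f
        ≈⟨ +-congˡ (*-congʳ (fromℕ-+ (2^ k) (2^ k))) ⟨
      f 𝟎 + fromℕ (2^ suc k) * 𝔼 f ∎))
    where
    open ≤-Reasoning
    mean : ∀ gs → 𝔼 (λ g → Σ[ (λ i → f (g ⊕ codeword {k} gs i)) ]) ≈ fromℕ (2^ k) * 𝔼 f
    mean gs = trans (𝔼-Σ (λ i g → f (g ⊕ codeword gs i)))
      (trans (sum-cong-≋ (λ i → 𝔼-shift f (codeword gs i))) (Σ-const (2^ k) (𝔼 f)))

-- Real powers

module Powers (R : RealField) (W : RealPower R) where
  open RealField R hiding (zero)
  open RealPower W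
  open OrderedField R
  open Moments R

  *-cancelˡ : ∀ {u x y} → 0# < u → u * x ≈ u * y → x ≈ y
  *-cancelˡ {u} {x} {y} 0<u ux≈uy with inverse 0<u
  ... | v , _ , uv≈1 = trans (divide x) (trans (*-congˡ ux≈uy) (sym (divide y)))
    where
    divide : ∀ z → z ≈ v * (u * z)
    divide z = trans (sym (*-identityˡ z)) (trans (*-congʳ (sym uv≈1))
      (solve 3 (λ u v z → u :* v :* z := v :* (u :* z)) refl u v z))

  -- By multiplicativity the value is idempotent, and being positive it can be cancelled.
  pow-one : ∀ a → ∣ 1# ∣^ a ≈ 1#
  pow-one a = *-cancelˡ (pow-pos a 0<1) (trans (sym (pow-distrib 1# 1# a))
    (trans (pow-cong (*-identityʳ 1#) refl) (sym (*-identityʳ _))))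

  -- A positive value would stay positive when raised to the inverse exponent, which however returns
  -- 0.
  pow-zero : ∀ a → ∣ 0# ∣^ a ≈ 0#
  pow-zero a@(x , 0<x) = <-tight (pow-nonneg 0# a) λ 0<0ᵃ →
    let y , 0<y , xy≈1 = inverse 0<x
    in <-irrefl (sym (trans (pow-* 0# a (y , 0<y) (1# , 0<1) xy≈1) (pow-1 ≤-refl))) (pow-pos (y , 0<y) 0<0ᵃ)

  pow≤0⇒≈0 : ∀ {x} a → ∣ x ∣^ a ≤ 0# → x ≈ 0#
  pow≤0⇒≈0 {x} a xᵃ≤0 = <-tight
    (λ x<0 → xᵃ≤0 (<-respʳ-≈ (pow-even x a) (pow-pos a (<-respʳ-≈ (+-identityˡ (- x)) (x<y⇒0<y-x x<0)))))
    (λ 0<x → xᵃ≤0 (pow-pos a 0<x))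

  pow-fromℕ : ∀ {x} q → 0# ≤ x → ∣ x ∣^ fromℕ⁺ (suc q) ≈ x ^ suc q
  pow-fromℕ {x} zero    0≤x = trans (pow-cong refl (+-identityʳ 1#)) (trans (pow-1 0≤x) (sym (*-identityʳ x)))
  pow-fromℕ {x} (suc q) 0≤x = trans (sym (pow-+ x (1# , 0<1) (fromℕ⁺ (suc q)) (fromℕ⁺ (suc (suc q))) refl))
    (*-cong (pow-1 0≤x) (pow-fromℕ q 0≤x))

  -- The missing factor, a positive power of a base at least 1, is at least 1.
  pow≤^ : ∀ {x} a q → 1# ≤ x → proj₁ a < fromℕ q → ∣ x ∣^ a ≤ x ^ q
  pow≤^ {x} (a , 0<a) zero    1≤x a<0 = contradiction a<0 (<-asym 0<a)
  pow≤^ {x} a@(α , 0<α) (suc q) 1≤x a<q = begin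
    ∣ x ∣^ a                   ≈⟨ *-identityʳ _ ⟨
    ∣ x ∣^ a * 1#              ≤⟨ *-monoʳ-≤ (pow-nonneg x a)
      (≤-trans (≤-reflexive (sym (pow-one rest))) (pow-mono rest 0≤1 1≤x)) ⟩
    ∣ x ∣^ a * ∣ x ∣^ rest     ≈⟨ pow-+ x a rest (fromℕ⁺ (suc q)) (solve 2 (λ a q → a :+ (q :- a) := q)
        refl α (fromℕ (suc q))) ⟩
    ∣ x ∣^ fromℕ⁺ (suc q)      ≈⟨ pow-fromℕ q (≤-trans 0≤1 1≤x) ⟩
    x ^ suc q                  ∎
    where
    open ≤-Reasoning
    rest : ℝ⁺
    rest = fromℕ (suc q) - α , x<y⇒0<y-x a<q

  pow≤base : ∀ {x} (a b : ℝ⁺) → 1# + proj₁ b ≈ proj₁ a → 0# ≤ x → x ≤ 1# → ∣ x ∣^ a ≤ x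
  pow≤base {x} a b 1+b≈a 0≤x x≤1 = begin
    ∣ x ∣^ a                       ≈⟨ pow-+ x (1# , 0<1) b a 1+b≈a ⟨
    ∣ x ∣^ (1# , 0<1) * ∣ x ∣^ b   ≤⟨ *-monoʳ-≤ (pow-nonneg x _)
        (≤-trans (pow-mono b 0≤x x≤1) (≤-reflexive (pow-one b))) ⟩
    ∣ x ∣^ (1# , 0<1) * 1#         ≈⟨ *-identityʳ _ ⟩
    ∣ x ∣^ (1# , 0<1)              ≈⟨ pow-1 0≤x ⟩
    x                              ∎
    where open ≤-Reasoning

  module _ {p : ℝ} (2<p : fromℕ 2 < p) where
    open Regression R W using (module Exponents)
    open Exponents 2<p

    pow-halves : ∀ x → ∣ x ∣^ p/2 * ∣ x ∣^ p/2 ≈ ∣ x ∣^ p⁺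
    pow-halves x = pow-+ x p/2 p/2 p⁺ (trans
      (solve 2 (λ p h → p :* h :+ p :* h := h :* (p :+ p)) refl p ½) (½*2 p))

    module _ (q : ℕ) (p/2<q : proj₁ p/2 < fromℕ q) where
      momentConstant : ℝ
      momentConstant = 1# + growth q ^ q

      momentConstant-pos : 0# < momentConstant
      momentConstant-pos = <-≤-trans 0<1 (x+d≈y⇒x≤y _ (^-nonneg q (growth-nonneg q)) refl)

      -- Either s² ≤ D, or the quotient s²/D is at least 1 and may be raised to
      -- the larger power q.
      pow≤moment : ∀ {D e} → 0# < D → 0# ≤ e → e * D ≈ 1# → ∀ s →
        ∣ s ∣^ p⁺ ≤ ∣ D ∣^ p/2 * (1# + e ^ q * (s * s) ^ q)
      pow≤moment {D} {e} 0<D 0≤e eD≈1 s = begin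
        ∣ s ∣^ p⁺                   ≈⟨ pow-halves s ⟨
        ∣ s ∣^ p/2 * ∣ s ∣^ p/2     ≈⟨ pow-distrib s s p/2 ⟨
        ∣ s * s ∣^ p/2              ≤⟨ ≤-cases (s * s) D small large ⟩
        ∣ D ∣^ p/2 * (1# + z ^ q)   ≈⟨ *-congˡ (+-congˡ (^-distrib-* e (s * s) q)) ⟩
        ∣ D ∣^ p/2 * (1# + e ^ q * (s * s) ^ q)   ∎
        where
        open ≤-Reasoning
        z = e * (s * s)
        0≤z : 0# ≤ z
        0≤z = *-nonneg 0≤e (square-nonneg s)
        Dz≈s² : D * z ≈ s * s
        Dz≈s² = trans (solve 3 (λ d e x → d :* (e :* x) := e :* d :* x) refl D e (s * s))
          (trans (*-congʳ eD≈1) (*-identityˡ _))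
        small : s * s ≤ D → ∣ s * s ∣^ p/2 ≤ ∣ D ∣^ p/2 * (1# + z ^ q)
        small s²≤D = begin
          ∣ s * s ∣^ p/2              ≤⟨ pow-mono p/2 (square-nonneg s) s²≤D ⟩
          ∣ D ∣^ p/2                  ≈⟨ *-identityʳ _ ⟨
          ∣ D ∣^ p/2 * 1#             ≤⟨ *-monoʳ-≤ (pow-nonneg D p/2) (x+d≈y⇒x≤y _ (^-nonneg q 0≤z) refl) ⟩
          ∣ D ∣^ p/2 * (1# + z ^ q)   ∎
        large : D ≤ s * s → ∣ s * s ∣^ p/2 ≤ ∣ D ∣^ p/2 * (1# + z ^ q)
        large D≤s² = begin
          ∣ s * s ∣^ p/2              ≈⟨ pow-cong Dz≈s² refl ⟨
          ∣ D * z ∣^ p/2              ≈⟨ pow-distrib D z p/2 ⟩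
          ∣ D ∣^ p/2 * ∣ z ∣^ p/2     ≤⟨ *-monoʳ-≤ (pow-nonneg D p/2) (pow≤^ p/2 q 1≤z p/2<q) ⟩
          ∣ D ∣^ p/2 * z ^ q          ≤⟨ *-monoʳ-≤ (pow-nonneg D p/2) (x+d≈y⇒x≤y 1# 0≤1 (+-comm _ _)) ⟩
          ∣ D ∣^ p/2 * (1# + z ^ q)   ∎
          where
          1≤z : 1# ≤ z
          1≤z = ≤-trans (≤-reflexive (sym eD≈1)) (*-monoʳ-≤ 0≤e D≤s²)

      ∣signSum∣^p : ∀ {d} → Vec Bool d → ℝ
      ∣signSum∣^p v = ∣ signSum v ∣^ p⁺

      -- The p-th moment of a sign sum is O(d^(p/2)). The pointwise bound reduces it to the 2q-th
      -- moment, whose factor D^q is cancelled by e^q.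
      𝔼-pow : ∀ d {e} → 0# ≤ e → e * fromℕ (suc d) ≈ 1# →
        𝔼 {suc d} ∣signSum∣^p ≤ ∣ fromℕ (suc d) ∣^ p/2 * momentConstant
      𝔼-pow d {e} 0≤e eD≈1 = begin
        𝔼 {suc d} ∣signSum∣^p
          ≤⟨ 𝔼-mono {suc d} (λ v → pow≤moment (fromℕ-pos d) 0≤e eD≈1 (signSum v)) ⟩
        𝔼 {suc d} (λ v → V * (1# + e ^ q * u v))
          ≈⟨ 𝔼-* {suc d} V (λ v → 1# + e ^ q * u v) ⟩
        V * 𝔼 {suc d} (λ v → 1# + e ^ q * u v)
          ≈⟨ *-congˡ (trans (𝔼-+ {suc d} (λ _ → 1#) (λ v → e ^ q * u v))
              (+-cong (𝔼-const (suc d) 1#) (𝔼-* {suc d} (e ^ q) u))) ⟩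
        V * (1# + e ^ q * 𝔼 {suc d} u)
          ≤⟨ *-monoʳ-≤ (pow-nonneg D p/2) (+-monoʳ-≤ 1#
              (*-monoʳ-≤ (^-nonneg q 0≤e) (signSum-moment q (suc d)))) ⟩
        V * (1# + e ^ q * (D * growth q) ^ q)
          ≈⟨ *-congˡ (+-congˡ (trans (sym (^-distrib-* e _ q)) (^-congˡ q
               (trans (sym (*-assoc e D _)) (trans (*-congʳ eD≈1) (*-identityˡ _)))))) ⟩
        V * (1# + growth q ^ q) ∎
        where
        open ≤-Reasoning
        D V : ℝ
        D = fromℕ (suc d)
        V = ∣ D ∣^ p/2
        u : Vec Bool (suc d) → ℝ
        u v = (signSum v * signSum v) ^ q

-- Queries

module Instances (R : RealField) (W : RealPower R) where
  open RealField R hiding (zero)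
  open RealPower W
  open OrderedField R
  open Probability R
  open Powers R W
  open Regression R W

  unit : ∀ {n} → Fin n → Vector ℝ n
  unit i j = if does (i Fin.≟ j) then 1# else 0#

  unit-self : ∀ {n} (i : Fin n) → unit i i ≡ 1#
  unit-self i = ≡.cong (λ b → if b then 1# else 0#) (dec-true (i Fin.≟ i) ≡.refl)

  unit-other : ∀ {n} {i j : Fin n} → i ≢ j → unit i j ≡ 0#
  unit-other {i = i} {j} i≢j = ≡.cong (λ b → if b then 1# else 0#) (dec-false (i Fin.≟ j) i≢j)

  origin : ∀ {n} → Vector ℝ n
  origin _ = 0#

  -- For target 0 the minimum is 0, so near-optimality forces coordinate `i` of `A · x` to vanish.
  -- Against `unit i` that coordinate alone costs 1, which exceeds what the loss of `y` permits.
  separation : ∀ {n d} p η (A : Matrix n d) i → 0# ≤ 1# + η →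
    ∀ y → (1# + η) * loss p A (unit i) y < 1# →
    ∀ x → NearOptimal p η A origin x → ¬ NearOptimal p η A (unit i) x
  separation {n} {d} p η A i 0≤1+η y y-good x (μ , (_ , μ≤) , x≤) (ν , (_ , ν≤) , x≤′) = contradiction
    (begin-strict
      1#                              ≈⟨ pow-one p ⟨
      ∣ 1# ∣^ p                       ≈⟨ pow-even 1# p ⟨
      ∣ - 1# ∣^ p                     ≈⟨ pow-cong residual refl ⟨
      ∣ (A · x) i - unit i i ∣^ p     ≤⟨ term≤Σ {f = λ j → ∣ (A · x) j - unit i j ∣^ p} (λ j → pow-nonneg _ p) i ⟩
      loss p A (unit i) x             ≤⟨ x≤′ ⟩
      (1# + η) * ν                    ≤⟨ *-monoʳ-≤ 0≤1+η (ν≤ y) ⟩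
      (1# + η) * loss p A (unit i) y  <⟨ y-good ⟩
      1#                              ∎) (<-irrefl refl)
    where
    open ≤-Reasoning
    loss-origin : loss p A origin origin ≈ 0#
    loss-origin = trans (sum-cong-≋ {n} λ j → trans (pow-cong {b = p}
        (trans (+-congʳ (trans (sum-cong-≋ {d} (λ c → zeroʳ (A j c)))
            (sum-replicate-zero d))) (-‿inverseʳ 0#)) refl)
      (pow-zero p)) (sum-replicate-zero n)
    Ax-i≈0 : (A · x) i ≈ 0#
    Ax-i≈0 = trans (solve 1 (λ z → z := z :- con (+ 0)) refl _) (pow≤0⇒≈0 p (begin
      ∣ (A · x) i - 0# ∣^ p              ≤⟨ term≤Σ
        {f = λ j → ∣ (A · x) j - 0# ∣^ p} (λ j → pow-nonneg _ p) i ⟩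
      loss p A origin x                  ≤⟨ x≤ ⟩
      (1# + η) * μ                       ≤⟨ *-monoʳ-≤ 0≤1+η (μ≤ origin) ⟩
      (1# + η) * loss p A origin origin  ≈⟨ trans (*-congˡ loss-origin) (zeroʳ _) ⟩
      0#                                 ∎))
    residual : (A · x) i - unit i i ≈ - 1#
    residual = trans (+-cong Ax-i≈0 (-‿cong (reflexive (unit-self i)))) (+-identityˡ _)

  -- Runs of one strategy on two targets.

  module _ {n d : ℕ} (s : Strategy n d) where
    private
      next : Vector ℝ n → List ℝ → List ℝ
      next b l = [ (λ i → b i ∷ l) , (λ _ → l) ]′ (s l)

      next-cong : ∀ {b c l m} → l ≡ m → (∀ i → s l ≡ inj₁ i → b i ≡ c i) → next b l ≡ next c m
      next-cong {l = l} ≡.refl agree with s l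
      ... | inj₁ i = ≡.cong (_∷ l) (agree i ≡.refl)
      ... | inj₂ _ = ≡.refl

      next-output : ∀ {b l x} → s l ≡ inj₂ x → next b l ≡ l
      next-output {l = l} sl≡ with s l | sl≡
      ... | inj₂ _ | ≡.refl = ≡.refl

    -- Agreement is asked only at entries that the run on `b` reads, and as `≡`, since a strategy
    -- may tell `≈`-equal answers apart.
    answers-agree : ∀ {b c} → (∀ k i → action s b k ≡ inj₁ i → b i ≡ c i) → ∀ k → answers s b k ≡ answers s c k
    answers-agree agree zero    = ≡.refl
    answers-agree agree (suc k) = next-cong (answers-agree agree k) (agree k)

    action-stays : ∀ {b x} k → action s b k ≡ inj₂ x → ∀ j → action s b (j ℕ.+ k) ≡ inj₂ x
    action-stays k out zero    = out
    action-stays k out (suc j) = ≡.trans (≡.cong s (next-output (action-stays k out j))) (action-stays k out j)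

    -- The runs may stop at different times; outputs persist, so both are compared at time `l + k`.
    outputs-agree : ∀ {b c} → (∀ k i → action s b k ≡ inj₁ i → b i ≡ c i) →
      ∀ {k l x y} → action s b k ≡ inj₂ x → action s c l ≡ inj₂ y → x ≡ y
    outputs-agree {b} {c} agree {k} {l} {x} {y} b-out c-out = inj₂-injective (begin
      inj₂ x                ≡⟨ action-stays k b-out l ⟨
      action s b (l ℕ.+ k)  ≡⟨ ≡.cong s (answers-agree agree (l ℕ.+ k)) ⟩
      action s c (l ℕ.+ k)  ≡⟨ ≡.cong (action s c) (ℕ.+-comm l k) ⟩
      action s c (k ℕ.+ l)  ≡⟨ action-stays l c-out k ⟩
      inj₂ y                ∎)
      where open ≡-Reasoning

  -- Partial sums of nonnegative terms increase, so the maximum of finitely many lengths serves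
  -- every `i`. One common length is needed to exchange the two sums.
  uniform-length : ∀ {n a} {s : Fin n → ℕ → ℝ} → (∀ i k → 0# ≤ s i k) →
    (∀ i → ∃[ L ] a < partialSum (s i) L) → ∃[ L ] (∀ i → a ≤ partialSum (s i) L)
  uniform-length {zero}  0≤s large = 0 , λ ()
  uniform-length {suc n} {a} {s} 0≤s large =
    let L , a<L  = large zero
        M , a≤M  = uniform-length (0≤s ∘ suc) (large ∘ suc)
    in L ℕ.⊔ M , λ where
      zero    → ≤-trans (<⇒≤ a<L) (partialSum-mono-≤ (0≤s zero) (ℕ.m≤m⊔n L M))
      (suc i) → ≤-trans (a≤M i) (partialSum-mono-≤ (0≤s (suc i)) (ℕ.m≤n⊔m L M))

  1/100 : ℝ
  1/100 = proj₁ (inverse (fromℕ-pos 99))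

  0<1/100 : 0# < 1/100
  0<1/100 = proj₁ (proj₂ (inverse (fromℕ-pos 99)))

  100*1/100 : fromℕ 100 * 1/100 ≈ 1#
  100*1/100 = proj₂ (proj₂ (inverse (fromℕ-pos 99)))

  module _ {n d : ℕ} (alg : RandomizedAlgorithm n d) where
    open RandomizedAlgorithm alg

    -- Every run fails on target 0, fails on `unit i`, or reads entry `i` on target 0: otherwise
    -- both runs give the same successful output, contradicting `separation`. The two failures have
    -- probability at most 1/100 each.
    reads-often : ∀ {p η} (A : Matrix n d) i → 0# ≤ 1# + η → Solves p η →
      ∀ y → (1# + η) * loss p A (unit i) y < 1# →
      ∃[ L ] fromℕ 2 * 1/100 < partialSum (λ k → P (reads-event A origin k i)) L
    reads-often {p} {η} A i 0≤1+η solves y y-good =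
      let e , e-bound = solves A origin
          f , f-bound = solves A (unit i)
          F : ℕ → Pred Ω 0ℓ
          F = λ where
            0             → ∁ (Outputs A origin (NearOptimal p η A origin))
            1             → ∁ (Outputs A (unit i) (NearOptimal p η A (unit i)))
            (suc (suc k)) → Reads A origin k i
          F-event : ∀ k → IsEvent (F k)
          F-event = λ where
            0             → event-∁ e
            1             → event-∁ f
            (suc (suc k)) → reads-event A origin k i
          cover : ∀ ω → ¬ (∀ k → ¬ F k ω)
          cover = λ ω none → none 0 λ (k , x , out , good) → none 1 λ (l , x′ , out′ , good′) →
            separation p η A i 0≤1+η y y-good x good
              (≡.subst (NearOptimal p η A (unit i)) (≡.sym (outputs-agree (strategy A ω)
                (λ k j read → ≡.sym (unit-other λ i≡j → none (suc (suc k))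
                    (≡.trans read (≡.cong inj₁ (≡.sym i≡j)))))
                {k} {l} out out′)) good′)
          -- The tolerance is 96/100, so the covering events have total above 4/100; the failures
          -- account for at most 2/100 of it.
          L , large = covering-sum space F F-event cover (*-pos (fromℕ-pos 95) 0<1/100)
          S = partialSum (λ k → P (reads-event A origin k i)) L
          small : ∀ {E} (g : IsEvent E) → fromℕ 99 / fromℕ⁺ 100 ≤ P g → P (event-∁ g) ≤ 1/100
          small g g-bound = ≤-trans (≤-reflexive (P-∁ g)) (≤-trans (+-monoʳ-≤ 1# (neg-mono g-bound))
            (≤-reflexive (trans (+-congʳ (sym 100*1/100))
              (solve 1 (λ r → con (+ 100) :* r :- con (+ 99) :* r := r) refl 1/100))))
      in L , (begin-strict
        fromℕ 2 * 1/100
          ≈⟨ solve 1 (λ r → con (+ 2) :* r := (con (+ 100) :* r :- con (+ 96) :* r) :- con (+ 2) :* r)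
              refl 1/100 ⟩
        (fromℕ 100 * 1/100 - fromℕ 96 * 1/100) - fromℕ 2 * 1/100
          ≈⟨ +-congʳ (+-congʳ 100*1/100) ⟩
        (1# - fromℕ 96 * 1/100) - fromℕ 2 * 1/100
          <⟨ +-monoˡ-< _ large ⟩
        partialSum (λ k → P (F-event k)) L - fromℕ 2 * 1/100
          -- Two more terms make room for the failures, leaving exactly `L` terms of reads.
          ≤⟨ +-monoˡ-≤ _ (partialSum-mono-≤ (λ k → P-nonneg (F-event k)) (ℕ.m≤n+m L 2)) ⟩
        (P (event-∁ e) + (P (event-∁ f) + S)) - fromℕ 2 * 1/100
          ≤⟨ +-monoˡ-≤ _ (+-mono-≤ (small e e-bound) (+-monoˡ-≤ S (small f f-bound))) ⟩
        (1/100 + (1/100 + S)) - fromℕ 2 * 1/100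
          ≈⟨ solve 2 (λ r s → (r :+ (r :+ s)) :- con (+ 2) :* r := s) refl 1/100 S ⟩
        S ∎)
      where
      open ≤-Reasoning
      neg-mono : ∀ {x y} → x ≤ y → - y ≤ - x
      neg-mono {x} {y} x≤y = x+d≈y⇒x≤y (y - x) (x≤y⇒0≤y-x x≤y) (solve 2 (λ x y → :- y :+ (y :- x) := :- x)
          refl x y)

    queries-bound : ∀ {p η m} (A : Matrix n d) → 0# ≤ 1# + η → Solves p η → ExpectedQueries≤ m →
      (∀ i → ∃[ y ] (1# + η) * loss p A (unit i) y < 1#) → fromℕ n * (fromℕ 2 * 1/100) ≤ m
    queries-bound {m = m} A 0≤1+η solves queries good =
      let L , often = uniform-length (λ i k → P-nonneg (reads-event A origin k i))
            (λ i → reads-often A i 0≤1+η solves (proj₁ (good i)) (proj₂ (good i)))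
      in begin
        fromℕ n * (fromℕ 2 * 1/100)                    ≈⟨ Σ-const n _ ⟨
        Σ[ (λ (_ : Fin n) → fromℕ 2 * 1/100) ]         ≤⟨ Σ-mono-≤ often ⟩
        Σ[ (λ i → partialSum (λ k → P (reads-event A origin k i)) L) ]
          ≈⟨ ∑-comm {n} {L} (λ i k → P (reads-event A origin (toℕ k) i)) ⟩
        partialSum (expectedReads A origin) L          ≤⟨ queries A origin L ⟩
        m                                              ∎
      where open ≤-Reasoning

-- The hard instances

n≤2^n : ∀ n → n ℕ.≤ 2^ n
n≤2^n zero    = ℕ.z≤n
n≤2^n (suc n) = ℕ.+-mono-≤ (1≤2^n n) (n≤2^n n)
  where
  1≤2^n : ∀ n → 1 ℕ.≤ 2^ n
  1≤2^n zero    = ℕ.≤-refl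
  1≤2^n (suc n) = ℕ.≤-trans (1≤2^n n) (ℕ.m≤m+n (2^ n) (2^ n))

module LowerBound (R : RealField) (W : RealPower R) where
  open RealField R hiding (zero)
  open RealPower W
  open OrderedField R
  open Moments R
  open Powers R W
  open Instances R W
  open Regression R W

  fromℕ-mono-≤ : ∀ {m n} → m ℕ.≤ n → fromℕ m ≤ fromℕ n
  fromℕ-mono-≤ {n = n} ℕ.z≤n = fromℕ-nonneg n
  fromℕ-mono-≤ (ℕ.s≤s m≤n)   = +-monoʳ-≤ 1# (fromℕ-mono-≤ m≤n)

  -- Descends from an Archimedean exponent. With N the current power of two, the alternatives N - 1
  -- < x and x < N overlap, so cotransitivity decides between them and `k` is computed
  -- constructively.
  ∃-log₂ : ∀ x → 0# ≤ x → ∃[ k ] (fromℕ (2^ k) - 1# ≤ x × x < fromℕ (2^ k) + fromℕ (2^ k))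
  ∃-log₂ x 0≤x = let n , x<n = archimedean x in descend n (begin-strict
      x                              <⟨ x<n ⟩
      fromℕ n                        ≤⟨ fromℕ-mono-≤ (n≤2^n n) ⟩
      fromℕ (2^ n)                   ≤⟨ x+d≈y⇒x≤y _ (fromℕ-nonneg (2^ n)) refl ⟩
      fromℕ (2^ n) + fromℕ (2^ n)    ∎)
    where
    open ≤-Reasoning
    descend : ∀ k → x < fromℕ (2^ k) + fromℕ (2^ k) →
        ∃[ k ] (fromℕ (2^ k) - 1# ≤ x × x < fromℕ (2^ k) + fromℕ (2^ k))
    descend zero    x<2 = 0 , ≤-trans (≤-reflexive (solve 0 ((con (+ 1) :+ con (+ 0)) :- con (+ 1)
        := con (+ 0)) refl)) 0≤x , x<2
    descend (suc k) x<N+N with <-cotrans (x+d≈y⇒x<y {fromℕ (2^ suc k) - 1#} {fromℕ (2^ suc k)} 1# 0<1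
      (solve 1 (λ y → y :- con (+ 1) :+ con (+ 1) := y) refl _)) x
    ... | inj₁ N-1<x = suc k , <⇒≤ N-1<x , x<N+N
    ... | inj₂ x<N   = descend k (<-respʳ-≈ (fromℕ-+ (2^ k) (2^ k)) x<N)

  -- Compares the sums away from `i` only; the terms `g i` and `f i` are added across to avoid
  -- subtraction.
  Σ-swap-term : ∀ {n} (f g : Vector ℝ n) i → (∀ j → i ≢ j → f j ≤ g j) → Σ[ f ] + g i ≤ f i + Σ[ g ]
  Σ-swap-term {suc n} f g i f≤g = begin
    Σ[ f ] + g i                        ≈⟨ +-congʳ (sum-remove {i = i} f) ⟩
    (f i + Σ[ removeAt f i ]) + g i     ≤⟨ +-monoˡ-≤ (g i) (+-monoʳ-≤ (f i)
        (Σ-mono-≤ λ j → f≤g (punchIn i j) (Fin.punchInᵢ≢i i j ∘ ≡.sym))) ⟩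
    (f i + Σ[ removeAt g i ]) + g i     ≈⟨ trans (+-assoc _ _ _) (+-congˡ (trans
        (+-comm _ _) (sym (sum-remove {i = i} g)))) ⟩
    f i + Σ[ g ]                        ∎
    where open ≤-Reasoning

  design : ∀ {k d} → Vec (Vec Bool d) k → Matrix (2^ k) d
  design gs i c = sign (lookup (codeword gs i) c)

  design-· : ∀ {k d} (gs : Vec (Vec Bool d) k) t i j →
    (design gs · (λ c → t * design gs i c)) j ≈ t * signSum (codeword gs i ⊕ codeword gs j)
  design-· gs t i j = signSum-⊕ t (codeword gs j) (codeword gs i)

  1/3 : ℝ
  1/3 = proj₁ (inverse (fromℕ-pos 2))

  0<1/3 : 0# < 1/3
  0<1/3 = proj₁ (proj₂ (inverse (fromℕ-pos 2)))

  3*1/3 : fromℕ 3 * 1/3 ≈ 1#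
  3*1/3 = proj₂ (proj₂ (inverse (fromℕ-pos 2)))

  module _ {p : ℝ} (2<p : fromℕ 2 < p) (q : ℕ) (p/2<q : proj₁ (Exponents.p/2 2<p) < fromℕ q) where
    open Exponents 2<p

    C : ℝ
    C = momentConstant 2<p q p/2<q

    C⁻¹ : ℝ
    C⁻¹ = proj₁ (inverse (momentConstant-pos 2<p q p/2<q))

    CC⁻¹≈1 : C * C⁻¹ ≈ 1#
    CC⁻¹≈1 = proj₂ (proj₂ (inverse (momentConstant-pos 2<p q p/2<q)))

    -- One third of `ε` is the share left to the off-diagonal loss, and `C⁻¹` cancels the moment
    -- constant.
    κ : ℝ
    κ = 1/3 * C⁻¹

    0<κ : 0# < κ
    0<κ = *-pos 0<1/3 (proj₁ (proj₂ (inverse (momentConstant-pos 2<p q p/2<q))))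

    φ : ∀ {d} → Vec Bool d → ℝ
    φ = ∣signSum∣^p 2<p q p/2<q

    module _ (d : ℕ) (ε : ℝ) (0<ε : 0# < ε) (ε<1 : ε < 1#) where
      private
        -- `e` is the inverse of the number `D` of columns, so `t` times row `i` takes the value `ε`
        -- at coordinate `i`.
        D e t V : ℝ
        D = fromℕ (suc d)
        e = proj₁ (inverse (fromℕ-pos d))
        t = ε * e
        V = ∣ D ∣^ p/2
        0≤e : 0# ≤ e
        0≤e = <⇒≤ (proj₁ (proj₂ (inverse (fromℕ-pos d))))
        eD≈1 : e * D ≈ 1#
        eD≈1 = trans (*-comm e D) (proj₂ (proj₂ (inverse (fromℕ-pos d))))
        ρ : ℝ
        ρ = rate (suc d) (ε , 0<ε)
        0≤κρ : 0# ≤ κ * ρ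
        0≤κρ = <⇒≤ (*-pos 0<κ (/-pos (pow-pos p/2 (fromℕ-pos d)) (∣ ε ∣^ p-1 , pow-pos p-1 0<ε)))

      -- This is where ε^(p-1) and d^(p/2) come from: a code of κρ words makes the
      -- off-diagonal loss equal to the error term.
      scaled-rate : ∣ t ∣^ p⁺ * (κ * ρ * (V * C)) ≈ ε * 1/3
      scaled-rate = begin-equality
        ∣ t ∣^ p⁺ * (κ * ρ * (V * C))
          ≈⟨ *-congʳ (trans (pow-distrib ε e p⁺) (*-cong
               (sym (pow-+ ε p-1 (1# , 0<1) p⁺ (solve 1 (λ p → (p :- con (+ 1)) :+ con (+ 1) := p) refl p)))
               (sym (pow-halves 2<p e)))) ⟩
        (E * ∣ ε ∣^ (1# , 0<1)) * (e′ * e′) * (1/3 * C⁻¹ * (V * E⁻¹) * (V * C))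
          ≈⟨ *-congʳ (*-congʳ (*-congˡ (pow-1 (<⇒≤ 0<ε)))) ⟩
        (E * ε) * (e′ * e′) * (1/3 * C⁻¹ * (V * E⁻¹) * (V * C))
          ≈⟨ solve 8 (λ E ε e′ h C⁻¹ V E⁻¹ C → (E :* ε) :* (e′ :* e′) :* (h :* C⁻¹ :* (V :* E⁻¹) :* (V :* C))
               := (E :* E⁻¹) :* (C :* C⁻¹) :* ((e′ :* V) :* (e′ :* V)) :* (ε :* h))
                   refl E ε e′ 1/3 C⁻¹ V E⁻¹ C ⟩
        (E * E⁻¹) * (C * C⁻¹) * ((e′ * V) * (e′ * V)) * (ε * 1/3)
          ≈⟨ *-congʳ (*-cong (*-cong (proj₂ (proj₂ (inverse 0<E))) CC⁻¹≈1) (*-cong e′V≈1 e′V≈1)) ⟩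
        1# * 1# * (1# * 1#) * (ε * 1/3)
          ≈⟨ solve 1 (λ x → con (+ 1) :* con (+ 1) :* (con (+ 1) :* con (+ 1)) :* x := x) refl (ε * 1/3) ⟩
        ε * 1/3 ∎
        where
        open ≤-Reasoning
        E E⁻¹ e′ : ℝ
        E = ∣ ε ∣^ p-1
        0<E : 0# < E
        0<E = pow-pos p-1 0<ε
        E⁻¹ = proj₁ (inverse 0<E)
        e′ = ∣ e ∣^ p/2
        e′V≈1 : e′ * V ≈ 1#
        e′V≈1 = trans (sym (pow-distrib e D p/2)) (trans (pow-cong eD≈1 refl) (pow-one p/2))

      -- Coordinate `i` contributes at most 1 - ε. The others contribute `τ` times the sum of `φ`
      -- over the translated code without its word `𝟎`; the greedy bound makes that sum at most N -
      -- 1 times the mean.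
      loss-unit : ∀ {k} (gs : Vec (Vec Bool (suc d)) k) →
        Σ[ φ ∘ codeword gs ] + 𝔼 {suc d} φ ≤ φ (𝟎 {suc d}) + fromℕ (2^ k) * 𝔼 {suc d} φ →
        fromℕ (2^ k) - 1# ≤ κ * ρ →
        ∀ i → loss p⁺ (design gs) (unit i) (λ c → t * design gs i c) ≤ (1# - ε) + ε * 1/3
      loss-unit {k} gs bound N-1≤κρ i = begin
        Σ[ f ]
          ≈⟨ solve 2 (λ x y → x := (x :+ y) :- y) refl Σ[ f ] (g i) ⟩
        (Σ[ f ] + g i) - g i
          ≤⟨ +-monoˡ-≤ (- g i) (Σ-swap-term f g i (λ j i≢j → ≤-reflexive (off-diagonal i≢j))) ⟩
        (f i + Σ[ g ]) - g i
          ≈⟨ +-cong (+-congˡ Σg) (-‿cong (*-congˡ (reflexive (≡.cong φ (⊕-self (codeword gs i)))))) ⟩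
        (f i + τ * Σφ) - τ * φ (𝟎 {suc d})
          -- The mean is added and subtracted to reach the form of `bound`.
          ≈⟨ solve 5 (λ f τ s m z → (f :+ τ :* s) :- τ :* z := f :+ τ :* ((s :+ m) :- (z :+ m)))
              refl (f i) τ Σφ M (φ (𝟎 {suc d})) ⟩
        f i + τ * ((Σφ + M) - (φ (𝟎 {suc d}) + M))
          ≤⟨ +-mono-≤ diagonal (*-monoʳ-≤ 0≤τ (+-monoˡ-≤ _ bound)) ⟩
        (1# - ε) + τ * ((φ (𝟎 {suc d}) + N * M) - (φ (𝟎 {suc d}) + M))
          ≈⟨ +-congˡ (*-congˡ (solve 3 (λ z n m → (z :+ n :* m) :- (z :+ m) := (n :- con (+ 1)) :* m)
              refl (φ (𝟎 {suc d})) N M)) ⟩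
        (1# - ε) + τ * ((N - 1#) * M)
          ≤⟨ +-monoʳ-≤ _ (*-monoʳ-≤ 0≤τ (≤-trans (*-monoˡ-≤ 0≤M N-1≤κρ)
               (*-monoʳ-≤ 0≤κρ (𝔼-pow 2<p q p/2<q d 0≤e eD≈1)))) ⟩
        (1# - ε) + τ * (κ * ρ * (V * C))
          ≈⟨ +-congˡ scaled-rate ⟩
        (1# - ε) + ε * 1/3 ∎
        where
        open ≤-Reasoning
        N M τ Σφ : ℝ
        N = fromℕ (2^ k)
        M = 𝔼 {suc d} φ
        τ = ∣ t ∣^ p⁺
        Σφ = Σ[ φ ∘ codeword gs ]
        f g : Vector ℝ (2^ k)
        f j = ∣ (design gs · (λ c → t * design gs i c)) j - unit i j ∣^ p⁺
        g j = τ * φ (codeword gs i ⊕ codeword gs j)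
        0≤τ : 0# ≤ τ
        0≤τ = pow-nonneg t p⁺
        0≤M : 0# ≤ M
        0≤M = ≤-trans (≤-reflexive (sym (𝔼-const (suc d) 0#))) (𝔼-mono {suc d} λ v → pow-nonneg (signSum v) p⁺)
        Σg : Σ[ g ] ≈ τ * Σφ
        Σg = trans (sym (*-distribˡ-sum τ (λ j → φ (codeword gs i ⊕ codeword gs j))))
            (*-congˡ (Σ-codeword-translate gs φ i))
        off-diagonal : ∀ {j} → i ≢ j → f j ≈ g j
        off-diagonal {j} i≢j = trans (pow-cong (trans
            (+-cong (design-· gs t i j) (-‿cong (reflexive (unit-other i≢j))))
          (solve 1 (λ x → x :- con (+ 0) := x) refl _)) refl) (pow-distrib t _ p⁺)
        residual : (design gs · (λ c → t * design gs i c)) i - unit i i ≈ - (1# - ε)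
        residual = begin-equality
          (design gs · (λ c → t * design gs i c)) i - unit i i
            ≈⟨ +-cong (trans (design-· gs t i i) (*-congˡ (trans
                (reflexive (≡.cong signSum (⊕-self (codeword gs i)))) (signSum-𝟎 (suc d)))))
                 (-‿cong (reflexive (unit-self i))) ⟩
          ε * e * D - 1#     ≈⟨ +-congʳ (trans (*-assoc ε e D) (trans (*-congˡ eD≈1) (*-identityʳ ε))) ⟩
          ε - 1#             ≈⟨ solve 1 (λ x → x :- con (+ 1) := :- (con (+ 1) :- x)) refl ε ⟩
          - (1# - ε)         ∎
        diagonal : f i ≤ 1# - ε
        diagonal = begin
          f i                     ≈⟨ pow-cong residual refl ⟩
          ∣ - (1# - ε) ∣^ p⁺      ≈⟨ pow-even (1# - ε) p⁺ ⟩
          ∣ 1# - ε ∣^ p⁺          ≤⟨ pow≤base p⁺ p-1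
              (solve 1 (λ p → con (+ 1) :+ (p :- con (+ 1)) := p) refl p)
              (x≤y⇒0≤y-x (<⇒≤ ε<1))
              (x+d≈y⇒x≤y ε (<⇒≤ 0<ε) (solve 1 (λ x → (con (+ 1) :- x) :+ x := con (+ 1)) refl ε)) ⟩
          1# - ε                  ∎

      -- With u = ε/3 the product is (1 + u)(1 - 2u) = 1 - u - 2u².
      relative-error : (1# + ε * 1/3) * ((1# - ε) + ε * 1/3) < 1#
      relative-error = x+d≈y⇒x<y (u + fromℕ 2 * (u * u)) (+-pos 0<u (*-pos (fromℕ-pos 1) (*-pos 0<u 0<u)))
          (begin-equality
        (1# + u) * ((1# - ε) + u) + (u + fromℕ 2 * (u * u))
          ≈⟨ +-congʳ (*-congˡ (+-congʳ (+-congˡ (-‿cong (trans (sym (*-identityʳ ε))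
              (*-congˡ (sym 3*1/3))))))) ⟩
        (1# + u) * ((1# - ε * (fromℕ 3 * 1/3)) + u) + (u + fromℕ 2 * (u * u))
          ≈⟨ solve 2 (λ ε h → (con (+ 1) :+ ε :* h) :* ((con (+ 1) :- ε :* (con (+ 3) :* h)) :+ ε :* h)
               :+ (ε :* h :+ con (+ 2) :* (ε :* h :* (ε :* h))) := con (+ 1)) refl ε 1/3 ⟩
        1# ∎)
        where
        open ≤-Reasoning
        u = ε * 1/3
        0<u : 0# < u
        0<u = *-pos 0<ε 0<1/3

      -- The number of rows is computed from `κ * ρ` alone. The code exists only up to double
      -- negation, which suffices because the final inequality is a negation.
      queries-≥-rate : ∃[ n ] (∀ (alg : RandomizedAlgorithm n (suc d)) →
        let open RandomizedAlgorithm alg in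
        Solves p⁺ (ε / fromℕ⁺ 3) → ∀ m → ExpectedQueries≤ m → 1/100 * κ * ρ ≤ m)
      queries-≥-rate = 2^ k , λ alg solves m queries m<cρ →
        ∃-code {suc d} φ k λ (gs , bound) → contradiction m<cρ (begin
          1/100 * κ * ρ          ≈⟨ *-assoc 1/100 κ ρ ⟩
          1/100 * (κ * ρ)        ≤⟨ *-monoʳ-≤ (<⇒≤ 0<1/100) (<⇒≤ κρ<N+N) ⟩
          1/100 * (N + N)        ≈⟨ solve 2 (λ r n → r :* (n :+ n) := n :* (con (+ 2) :* r)) refl 1/100 N ⟩
          N * (fromℕ 2 * 1/100)  ≤⟨ queries-bound alg (design gs) 0≤1+η solves queries
              (λ i → (λ c → t * design gs i c) ,
            ≤-<-trans (*-monoʳ-≤ 0≤1+η (loss-unit gs bound N-1≤κρ i)) relative-error) ⟩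
          m                      ∎)
        where
        open ≤-Reasoning
        size = ∃-log₂ (κ * ρ) 0≤κρ
        k = proj₁ size
        N-1≤κρ = proj₁ (proj₂ size)
        κρ<N+N = proj₂ (proj₂ size)
        N = fromℕ (2^ k)
        0≤1+η : 0# ≤ 1# + ε * 1/3
        0≤1+η = +-nonneg 0≤1 (<⇒≤ (*-pos 0<ε 0<1/3))

theorem13p2 : (R : RealField) (W : RealPower R) →
    let open RealField R
        open Regression R W
    in
    (p : ℝ) (2<p : fromℕ 2 < p) →
    let open Exponents 2<p in
    ∃[ c ] (0# < c ×
      (∀ (d : ℕ) (ε : ℝ) (0<ε : 0# < ε) → ε < 1# →
        ∃[ n ] (∀ (alg : RandomizedAlgorithm n d) →
          let open RandomizedAlgorithm alg in
          Solves p⁺ (ε / fromℕ⁺ 3) →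
          ∀ (m : ℝ) → ExpectedQueries≤ m →
          c * rate d (ε , 0<ε) ≤ m)))
-- The constant depends on `p` only, through a natural number `q` above p/2.
theorem13p2 R W p 2<p with RealField.archimedean R (proj₁ (Regression.Exponents.p/2 R W 2<p))
... | q , p/2<q = 1/100 * κ 2<p q p/2<q , *-pos 0<1/100 (0<κ 2<p q p/2<q) , λ where
      -- Without columns the rate is 0, and `m` is nonnegative by the empty partial sum.
      zero    ε 0<ε ε<1 → 0 , λ alg solves m queries →
        ≤-trans (≤-reflexive (trans (*-congˡ (trans (*-congʳ (pow-zero p/2)) (zeroˡ _))) (zeroʳ _)))
          (queries (λ ()) (λ ()) 0)
      (suc d) ε 0<ε ε<1 → queries-≥-rate 2<p q p/2<q d ε 0<ε ε<1
  where
  open RealField R hiding (zero)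
  open OrderedField R using (≤-trans; ≤-reflexive)
  open Powers R W using (pow-zero)
  open Instances R W using (1/100; 0<1/100)
  open LowerBound R W
  open Regression.Exponents R W 2<p using (p/2)
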